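{- Let $G$ be a graph with maximum degree $\Delta \ge 24$. Then $$\chi_a(G) < \min\left\{\frac32\Delta^{\frac43} + 5\Delta - 14,\ \ \frac32\Delta^{\frac43} + \Delta + \frac{8\Delta^{\frac43}}{\Delta^{\frac23}-4} + 1\right\}.$$
   Context: An acyclic coloring of a graph is a proper vertex-coloring in which no cycle is bicolored (equivalently, the subgraph induced by any two color classes is a forest). $\chi_a(G)$, the acyclic chromatic number, is the minimum number of colors in an acyclic coloring of $G$. -}

module Defs where

open import Data.Fin.Base as Fin using (Fin; zero; suc; inject₁; fromℕ; fromℕ<; toℕ; finToFun; funToFin)
import Data.Fin.Properties as Finₚ
open import Data.Integer.Base as ℤ using (+_; +[1+_]; +0; -[1+_])
import Data.Integer.Properties as ℤₚ
open import Data.List.Base using (length; filter; allFin; map)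
open import Data.List.Extrema.Nat using (max)
open import Data.Nat.Base as ℕ using (ℕ; zero; suc; z≤n; s≤s)
import Data.Nat.Properties as ℕₚ
open import Data.Product.Base using (Σ; ∃; _×_; _,_; proj₁; proj₂)
open import Data.Rational.Base
import Data.Rational.Properties as ℚₚ
open import Data.Rational.Solver using (module +-*-Solver)
import Data.Rational.Unnormalised.Base as ℚᵘ
import Data.Rational.Unnormalised.Properties as ℚᵘₚ
open import Data.Sum.Base using (_⊎_; inj₁; inj₂)
open import Function.Base using (_∘_)
open import Function.Definitions using (Injective)
open import Level using (0ℓ)
open import Relation.Binary.Core using (Rel)
open import Relation.Binary.Definitions using (Symmetric; Irreflexive; Decidable)
open import Relation.Binary.PropositionalEquality
  using (_≡_; _≢_; _≗_; refl; sym; trans; cong; cong₂; subst; subst₂)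
open import Relation.Nullary using (¬_; Dec; yes; no; ¬?; _×-dec_; _⊎-dec_; _→-dec_; contradiction)
open import Relation.Nullary.Decidable using (True; map′; toWitness)

record Graph (n : ℕ) : Set₁ where
  infix 4 _~_ _~?_
  field
    _~_         : Rel (Fin n) 0ℓ
    symmetric   : Symmetric _~_
    irreflexive : Irreflexive _≡_ _~_
    _~?_        : Decidable _~_

module _ {n : ℕ} (G : Graph n) where
  open Graph G

  degree : Fin n → ℕ
  degree v = length (filter (v ~?_) (allFin n))

  maxDegree : ℕ
  maxDegree = max 0 (map degree (allFin n))

  -- v₀, v₁, …, v₍ₗ₊₂₎ are the vertices of a cycle of length l + 3 in order.
  record IsCycle {l : ℕ} (v : Fin (3 ℕ.+ l) → Fin n) : Set where
    field
      distinct : Injective _≡_ _≡_ v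
      adjacent : ∀ i → v (inject₁ i) ~ v (suc i)
      closing  : v (fromℕ (2 ℕ.+ l)) ~ v zero

  Proper : ∀ {k} → (Fin n → Fin k) → Set
  Proper c = ∀ u v → u ~ v → c u ≢ c v

-- At most two colours occur; for a cycle in a proper colouring this means
-- exactly two.
Bicoloured : ∀ {m n k} → (Fin n → Fin k) → (Fin m → Fin n) → Set
Bicoloured c v = ∃ λ a → ∃ λ b → ∀ i → c (v i) ≡ a ⊎ c (v i) ≡ b

module _ {n : ℕ} (G : Graph n) where
  open Graph G

  record IsAcyclicColouring {k : ℕ} (c : Fin n → Fin k) : Set where
    field
      proper  : Proper G c
      acyclic : ∀ {l} (v : Fin (3 ℕ.+ l) → Fin n) → IsCycle G v → ¬ Bicoloured c v

  AcyclicallyColourable : ℕ → Set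
  AcyclicallyColourable k = Σ (Fin n → Fin k) IsAcyclicColouring

-- Everything here is finite, so colourability is decidable and the least
-- number of colours can be found by search.

private
  any→? : ∀ {m n} {P : (Fin m → Fin n) → Set} →
          (∀ {f g} → f ≗ g → P f → P g) → (∀ f → Dec (P f)) → Dec (∃ P)
  any→? resp P? = map′
    (λ (i , p) → finToFun i , p)
    (λ (f , p) → funToFin f , resp (λ i → sym (Finₚ.finToFun-funToFin f i)) p)
    (Finₚ.any? (P? ∘ finToFun))

  least : ∀ {P : ℕ → Set} → (∀ k → Dec (P k)) → ∀ N → P N →
          ∃ λ k → P k × (∀ j → P j → k ℕ.≤ j)
  least P? N pN with P? 0
  ... | yes p0 = 0 , p0 , λ _ _ → z≤n
  least P? zero    pN | no ¬p0 = contradiction pN ¬p0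
  least P? (suc N) pN | no ¬p0 with least (P? ∘ suc) N pN
  ... | k , pk , min = suc k , pk , λ where
    zero    p → contradiction p ¬p0
    (suc j) p → s≤s (min j p)

module _ {n : ℕ} (G : Graph n) where
  open Graph G
  open IsCycle
  open IsAcyclicColouring

  private
    isCycle? : ∀ {l} (v : Fin (3 ℕ.+ l) → Fin n) → Dec (IsCycle G v)
    isCycle? {l} v = map′
      (λ (d , a , e) → record { distinct = d _ _ ; adjacent = a ; closing = e })
      (λ C → (λ _ _ → distinct C) , adjacent C , closing C)
      ((Finₚ.all? λ i → Finₚ.all? λ j → (v i Finₚ.≟ v j) →-dec (i Finₚ.≟ j))
        ×-dec (Finₚ.all? λ i → v (inject₁ i) ~? v (suc i))
        ×-dec (v (fromℕ (2 ℕ.+ l)) ~? v zero))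

    isCycle-resp : ∀ {l} {v w : Fin (3 ℕ.+ l) → Fin n} → v ≗ w → IsCycle G v → IsCycle G w
    isCycle-resp e C .distinct {i} {j} q = distinct C (trans (e i) (trans q (sym (e j))))
    isCycle-resp e C .adjacent i = subst₂ _~_ (e _) (e _) (adjacent C i)
    isCycle-resp e C .closing    = subst₂ _~_ (e _) (e _) (closing C)

    bicoloured? : ∀ {m k} (c : Fin n → Fin k) (v : Fin m → Fin n) → Dec (Bicoloured c v)
    bicoloured? c v = Finₚ.any? λ a → Finₚ.any? λ b → Finₚ.all? λ i →
      (c (v i) Finₚ.≟ a) ⊎-dec (c (v i) Finₚ.≟ b)

    bicoloured-resp : ∀ {m k} {c d : Fin n → Fin k} {v w : Fin m → Fin n} →
                      c ∘ v ≗ d ∘ w → Bicoloured c v → Bicoloured d w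
    bicoloured-resp e (a , b , p) = a , b , λ i → subst (λ x → x ≡ a ⊎ x ≡ b) (e i) (p i)

    BadCycle : ∀ {k} → (Fin n → Fin k) → ℕ → Set
    BadCycle c l = ∃ λ (v : Fin (3 ℕ.+ l) → Fin n) → IsCycle G v × Bicoloured c v

    badCycle? : ∀ {k} (c : Fin n → Fin k) l → Dec (BadCycle c l)
    badCycle? c l = any→?
      (λ {f} {g} e (C , b) → isCycle-resp e C , bicoloured-resp {c = c} {c} {f} {g} (λ i → cong c (e i)) b)
      (λ v → isCycle? v ×-dec bicoloured? c v)

    isAcyclicColouring? : ∀ {k} (c : Fin n → Fin k) → Dec (IsAcyclicColouring G c)
    isAcyclicColouring? {k} c = map′ to from
      ((Finₚ.all? λ u → Finₚ.all? λ v → (u ~? v) →-dec ¬? (c u Finₚ.≟ c v))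
        ×-dec ¬? (Finₚ.any? {n = n} (badCycle? c ∘ toℕ)))
      where
      Bounded : Set
      Bounded = Proper G c × ¬ ∃ λ (l : Fin n) → BadCycle c (toℕ l)
      to : Bounded → IsAcyclicColouring G c
      to (p , q) .proper = p
      to (p , q) .acyclic {l} v C b =
        q (fromℕ< l<n , subst (BadCycle c) (sym (Finₚ.toℕ-fromℕ< l<n)) (v , C , b))
        where
        l<n : l ℕ.< n
        l<n = ℕₚ.≤-trans (s≤s (ℕₚ.m≤n+m l 2)) (Finₚ.injective⇒≤ {f = v} (distinct C))
      from : IsAcyclicColouring G c → Bounded
      from A = proper A , λ (_ , v , C , b) → acyclic A v C b

    isAcyclicColouring-resp : ∀ {k} {c d : Fin n → Fin k} → c ≗ d →
                              IsAcyclicColouring G c → IsAcyclicColouring G d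
    isAcyclicColouring-resp e A .proper u v a q = proper A u v a (trans (e u) (trans q (sym (e v))))
    isAcyclicColouring-resp {c = c} {d} e A .acyclic v C b =
      acyclic A v C (bicoloured-resp {c = d} {c} {v} {v} (λ i → sym (e (v i))) b)

  acyclicallyColourable? : ∀ k → Dec (AcyclicallyColourable G k)
  acyclicallyColourable? k = any→? isAcyclicColouring-resp isAcyclicColouring?

  trivialColouring : AcyclicallyColourable G n
  trivialColouring = (λ v → v) , record
    { proper  = λ u v a q → irreflexive q a
    ; acyclic = λ v C (a , b , p) → three v C (p zero) (p (suc zero)) (p (suc (suc zero)))
    }
    where
    three : ∀ {l a b} (v : Fin (3 ℕ.+ l) → Fin n) → IsCycle G v →
            v zero ≡ a ⊎ v zero ≡ b → v (suc zero) ≡ a ⊎ v (suc zero) ≡ b →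
            v (suc (suc zero)) ≡ a ⊎ v (suc (suc zero)) ≡ b → _
    three v C (inj₁ p) (inj₁ q) _        with () ← distinct C (trans p (sym q))
    three v C (inj₂ p) (inj₂ q) _        with () ← distinct C (trans p (sym q))
    three v C (inj₁ p) (inj₂ q) (inj₁ r) with () ← distinct C (trans p (sym r))
    three v C (inj₁ p) (inj₂ q) (inj₂ r) with () ← distinct C (trans q (sym r))
    three v C (inj₂ p) (inj₁ q) (inj₁ r) with () ← distinct C (trans q (sym r))
    three v C (inj₂ p) (inj₁ q) (inj₂ r) with () ← distinct C (trans p (sym r))

  private
    minimum : ∃ λ k → AcyclicallyColourable G k × (∀ j → AcyclicallyColourable G j → k ℕ.≤ j)
    minimum = least acyclicallyColourable? n trivialColouring

  χₐ : ℕ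
  χₐ = proj₁ minimum

  χₐ-colourable : AcyclicallyColourable G χₐ
  χₐ-colourable = proj₁ (proj₂ minimum)

  χₐ-minimal : ∀ k → AcyclicallyColourable G k → χₐ ℕ.≤ k
  χₐ-minimal = proj₂ (proj₂ minimum)

infix 4 _<ℝ_ _≃ℝ_
infixl 6 _+ℝ_ _-ℝ_ _⊓ℝ_
infixl 7 _*ℝ_ divℝ
infix 8 -ℝ_
infixr 8 _^ℝ_

IsCauchy : (ℕ → ℚ) → Set
IsCauchy x = ∀ ε → 0ℚ < ε →
  ∃ λ N → ∀ m n → N ℕ.≤ m → N ℕ.≤ n → ∣ x m - x n ∣ < ε

record ℝ : Set where
  constructor mkℝ
  field
    seq    : ℕ → ℚ
    cauchy : IsCauchy seq

open ℝ public

_≃ℝ_ : ℝ → ℝ → Set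
x ≃ℝ y = ∀ ε → 0ℚ < ε → ∃ λ N → ∀ n → N ℕ.≤ n → ∣ seq x n - seq y n ∣ < ε

_<ℝ_ : ℝ → ℝ → Set
x <ℝ y = ∃ λ ε → 0ℚ < ε × ∃ λ N → ∀ n → N ℕ.≤ n → seq x n + ε ≤ seq y n

_#0 : ℝ → Set
x #0 = ∃ λ δ → 0ℚ < δ × ∃ λ N → ∀ n → N ℕ.≤ n → δ ≤ ∣ seq x n ∣

private
  open ℚₚ.≤-Reasoning
  open +-*-Solver using (solve; _:+_; _:*_; _:-_; :-_; _:=_)

  ∣∣< : ∀ {p r} → p < r → - p < r → ∣ p ∣ < r
  ∣∣< {p} p<r -p<r with ℚₚ.∣p∣≡p∨∣p∣≡-p p
  ... | inj₁ e = subst (_< _) (sym e) p<r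
  ... | inj₂ e = subst (_< _) (sym e) -p<r

  p≤∣p∣ : ∀ p → p ≤ ∣ p ∣
  p≤∣p∣ p with ℚₚ.≤-total 0ℚ p
  ... | inj₁ 0≤p = ℚₚ.≤-reflexive (sym (ℚₚ.0≤p⇒∣p∣≡p 0≤p))
  ... | inj₂ p≤0 = ℚₚ.≤-trans p≤0 (ℚₚ.0≤∣p∣ p)

  ∣p-q∣≡∣q-p∣ : ∀ p q → ∣ p - q ∣ ≡ ∣ q - p ∣
  ∣p-q∣≡∣q-p∣ p q = trans (cong ∣_∣ (solve 2 (λ p q → p :- q := :- (q :- p)) refl p q)) (ℚₚ.∣-p∣≡∣p∣ (q - p))

  ∣-∣<⇒< : ∀ {p q r} → ∣ p - q ∣ < r → p < q + r
  ∣-∣<⇒< {p} {q} {r} h = begin-strict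
    p           ≡⟨ solve 2 (λ p q → p := q :+ (p :- q)) refl p q ⟩
    q + (p - q) ≤⟨ ℚₚ.+-monoʳ-≤ q (p≤∣p∣ (p - q)) ⟩
    q + ∣ p - q ∣ <⟨ ℚₚ.+-monoʳ-< q h ⟩
    q + r       ∎

  <+⇒-< : ∀ {p q r} → p < q + r → p - q < r
  <+⇒-< {p} {q} {r} h = begin-strict
    p - q       <⟨ ℚₚ.+-monoˡ-< (- q) h ⟩
    (q + r) - q ≡⟨ solve 2 (λ q r → (q :+ r) :- q := r) refl q r ⟩
    r           ∎

  <⇒∣-∣< : ∀ {p q r} → p < q + r → q < p + r → ∣ p - q ∣ < r
  <⇒∣-∣< {p} {q} {r} h k = ∣∣< (<+⇒-< h)
    (subst (_< r) (solve 2 (λ p q → q :- p := :- (p :- q)) refl p q) (<+⇒-< k))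

  0≤⇒*-mono : ∀ {p q r s} → 0ℚ ≤ p → p ≤ q → 0ℚ ≤ r → r ≤ s → p * r ≤ q * s
  0≤⇒*-mono {p} {q} {r} {s} 0≤p p≤q 0≤r r≤s = begin
    p * r ≤⟨ ℚₚ.*-monoʳ-≤-nonNeg r {{nonNegative 0≤r}} p≤q ⟩
    q * r ≤⟨ ℚₚ.*-monoˡ-≤-nonNeg q {{nonNegative (ℚₚ.≤-trans 0≤p p≤q)}} r≤s ⟩
    q * s ∎

  0<* : ∀ {p q} → 0ℚ < p → 0ℚ < q → 0ℚ < p * q
  0<* {p} {q} 0<p 0<q = ℚₚ.positive⁻¹ (p * q)
    {{ℚₚ.pos*pos⇒pos p {{positive 0<p}} q {{positive 0<q}}}}

  scale : ∀ K → 0ℚ < K → ∀ ε → 0ℚ < ε → ∃ λ ε′ → 0ℚ < ε′ × K * ε′ ≡ ε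
  scale K 0<K ε 0<ε = ε * inv , 0<* 0<ε (ℚₚ.positive⁻¹ inv {{ℚₚ.1/pos⇒pos K {{posK}}}}) , eq
    where
    posK = positive 0<K
    inv = (1/ K) {{ℚₚ.pos⇒nonZero K {{posK}}}}
    eq : K * (ε * inv) ≡ ε
    eq = begin-equality
      K * (ε * inv) ≡⟨ solve 3 (λ K ε i → K :* (ε :* i) := ε :* (K :* i)) refl K ε inv ⟩
      ε * (K * inv) ≡⟨ cong (ε *_) (ℚₚ.*-inverseʳ K {{ℚₚ.pos⇒nonZero K {{posK}}}}) ⟩
      ε * 1ℚ        ≡⟨ ℚₚ.*-identityʳ ε ⟩
      ε             ∎

  0<1 : 0ℚ < 1ℚ
  0<1 = toWitness {a? = 0ℚ ℚₚ.<? 1ℚ} _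

  half : ∀ ε → 0ℚ < ε → ∃ λ ε′ → 0ℚ < ε′ × ε′ + ε′ ≡ ε
  half ε 0<ε = halve (scale (1ℚ + 1ℚ) (ℚₚ.+-mono-< 0<1 0<1) ε 0<ε)
    where
    halve : (∃ λ ε′ → 0ℚ < ε′ × (1ℚ + 1ℚ) * ε′ ≡ ε) → ∃ λ ε′ → 0ℚ < ε′ × ε′ + ε′ ≡ ε
    halve (ε′ , p , e) = ε′ , p , trans (sym (trans (ℚₚ.*-distribʳ-+ ε′ 1ℚ 1ℚ)
      (cong₂ _+_ (ℚₚ.*-identityˡ ε′) (ℚₚ.*-identityˡ ε′)))) e

  ⊔-left : ∀ {M N k} → M ℕ.⊔ N ℕ.≤ k → M ℕ.≤ k
  ⊔-left {M} {N} = ℕₚ.≤-trans (ℕₚ.m≤m⊔n M N)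

  ⊔-right : ∀ {M N k} → M ℕ.⊔ N ℕ.≤ k → N ℕ.≤ k
  ⊔-right {M} {N} = ℕₚ.≤-trans (ℕₚ.m≤n⊔m M N)

  bound : ∀ {x} → IsCauchy x → ∃ λ B → 0ℚ < B × ∃ λ N → ∀ n → N ℕ.≤ n → ∣ x n ∣ ≤ B
  bound {x} xc with xc 1ℚ 0<1
  ... | N , h = ∣ x N ∣ + 1ℚ , ℚₚ.+-mono-≤-< (ℚₚ.0≤∣p∣ (x N)) 0<1 , N , λ n N≤n → begin
    ∣ x n ∣               ≡⟨ cong ∣_∣ (solve 2 (λ p q → p := q :+ (p :- q)) refl (x n) (x N)) ⟩
    ∣ x N + (x n - x N) ∣ ≤⟨ ℚₚ.∣p+q∣≤∣p∣+∣q∣ (x N) (x n - x N) ⟩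
    ∣ x N ∣ + ∣ x n - x N ∣ ≤⟨ ℚₚ.+-monoʳ-≤ ∣ x N ∣ (ℚₚ.<⇒≤ (h n N N≤n ℕₚ.≤-refl)) ⟩
    ∣ x N ∣ + 1ℚ          ∎

fromℚ : ℚ → ℝ
fromℚ q = mkℝ (λ _ → q) λ ε 0<ε → 0 , λ _ _ _ _ →
  subst (_< ε) (sym (cong ∣_∣ (ℚₚ.+-inverseʳ q))) 0<ε

ι : ℕ → ℚ
ι n = + n / 1

fromℕℝ : ℕ → ℝ
fromℕℝ n = fromℚ (ι n)

private
  +-close : ∀ {a b c d r s} → ∣ a - c ∣ < r → ∣ b - d ∣ < s → ∣ (a + b) - (c + d) ∣ < r + s
  +-close {a} {b} {c} {d} h k = ℚₚ.≤-<-trans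
    (subst (λ z → ∣ z ∣ ≤ ∣ a - c ∣ + ∣ b - d ∣) (regroup a b c d) (ℚₚ.∣p+q∣≤∣p∣+∣q∣ (a - c) (b - d)))
    (ℚₚ.+-mono-< h k)
    where
    regroup : ∀ a b c d → (a - c) + (b - d) ≡ (a + b) - (c + d)
    regroup = solve 4 (λ a b c d → (a :- c) :+ (b :- d) := (a :+ b) :- (c :+ d)) refl

  neg-close : ∀ {a c r} → ∣ a - c ∣ < r → ∣ (- a) - (- c) ∣ < r
  neg-close {a} {c} {r} h = subst (_< r) (trans (∣p-q∣≡∣q-p∣ a c) (cong ∣_∣ (regroup a c))) h
    where
    regroup : ∀ a c → c - a ≡ (- a) - (- c)
    regroup = solve 2 (λ a c → c :- a := (:- a) :- (:- c)) refl

_+ℝ_ : ℝ → ℝ → ℝ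
mkℝ x xc +ℝ mkℝ y yc = mkℝ (λ n → x n + y n) λ ε 0<ε →
  let η , 0<η , η+η≡ε = half ε 0<ε
      M , f = xc η 0<η
      N , g = yc η 0<η
  in M ℕ.⊔ N , λ m n p q → subst (_ <_) η+η≡ε
    (+-close {x m} {y m} {x n} {y n} (f m n (⊔-left p) (⊔-left q)) (g m n (⊔-right {M} p) (⊔-right {M} q)))

-ℝ_ : ℝ → ℝ
-ℝ mkℝ x xc = mkℝ (λ n → - x n) λ ε 0<ε →
  let N , f = xc ε 0<ε
  in N , λ m n p q → neg-close {x m} {x n} (f m n p q)

_-ℝ_ : ℝ → ℝ → ℝ
x -ℝ y = x +ℝ (-ℝ y)

private
  *-close : ∀ {a b c d B C r} → 0ℚ < B → 0ℚ < C → ∣ a ∣ ≤ B → ∣ d ∣ ≤ C →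
            ∣ a - c ∣ < r → ∣ b - d ∣ < r → ∣ a * b - c * d ∣ < (B + C) * r
  *-close {a} {b} {c} {d} {B} {C} {r} 0<B 0<C a≤B d≤C h k = begin-strict
    ∣ a * b - c * d ∣
      ≡⟨ cong ∣_∣ (regroup a b c d) ⟩
    ∣ a * (b - d) + (a - c) * d ∣
      ≤⟨ ℚₚ.∣p+q∣≤∣p∣+∣q∣ (a * (b - d)) ((a - c) * d) ⟩
    ∣ a * (b - d) ∣ + ∣ (a - c) * d ∣
      ≡⟨ cong₂ _+_ (ℚₚ.∣p*q∣≡∣p∣*∣q∣ a (b - d)) (ℚₚ.∣p*q∣≡∣p∣*∣q∣ (a - c) d) ⟩
    ∣ a ∣ * ∣ b - d ∣ + ∣ a - c ∣ * ∣ d ∣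
      ≤⟨ ℚₚ.+-mono-≤
           (0≤⇒*-mono (ℚₚ.0≤∣p∣ a) a≤B (ℚₚ.0≤∣p∣ (b - d)) ℚₚ.≤-refl)
           (0≤⇒*-mono (ℚₚ.0≤∣p∣ (a - c)) ℚₚ.≤-refl (ℚₚ.0≤∣p∣ d) d≤C) ⟩
    B * ∣ b - d ∣ + ∣ a - c ∣ * C
      <⟨ ℚₚ.+-mono-<
           (ℚₚ.*-monoʳ-<-pos B {{positive 0<B}} k)
           (ℚₚ.*-monoˡ-<-pos C {{positive 0<C}} h) ⟩
    B * r + r * C
      ≡⟨ cong (_+_ (B * r)) (ℚₚ.*-comm r C) ⟩
    B * r + C * r
      ≡⟨ ℚₚ.*-distribʳ-+ r B C ⟨
    (B + C) * r ∎
    where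
    regroup : ∀ a b c d → a * b - c * d ≡ a * (b - d) + (a - c) * d
    regroup = solve 4 (λ a b c d → a :* b :- c :* d := a :* (b :- d) :+ (a :- c) :* d) refl

_*ℝ_ : ℝ → ℝ → ℝ
mkℝ x xc *ℝ mkℝ y yc = mkℝ (λ n → x n * y n) λ ε 0<ε →
  let B , 0<B , K , f = bound xc
      C , 0<C , L , g = bound yc
      η , 0<η , e = scale (B + C) (ℚₚ.+-mono-< 0<B 0<C) ε 0<ε
      M , h = xc η 0<η
      N , k = yc η 0<η
  in (K ℕ.⊔ L) ℕ.⊔ (M ℕ.⊔ N) , λ m n p q → subst (_ <_) e
    (*-close {x m} {y m} {x n} {y n} 0<B 0<C
      (f m (⊔-left (⊔-left p))) (g n (⊔-right {K} (⊔-left q)))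
      (h m n (⊔-left (⊔-right {K ℕ.⊔ L} p)) (⊔-left (⊔-right {K ℕ.⊔ L} q)))
      (k m n (⊔-right {M} (⊔-right {K ℕ.⊔ L} p)) (⊔-right {M} (⊔-right {K ℕ.⊔ L} q))))

_^ℝ_ : ℝ → ℕ → ℝ
x ^ℝ zero  = fromℕℝ 1
x ^ℝ suc n = x *ℝ (x ^ℝ n)

private
  ⊓-below : ∀ {a b c d r} → a < c + r → b < d + r → a ⊓ b < (c ⊓ d) + r
  ⊓-below {a} {b} {c} {d} {r} h k = pick (ℚₚ.⊓-sel c d)
    where
    pick : c ⊓ d ≡ c ⊎ c ⊓ d ≡ d → a ⊓ b < (c ⊓ d) + r
    pick (inj₁ e) = subst (λ z → a ⊓ b < z + r) (sym e) (ℚₚ.≤-<-trans (ℚₚ.p⊓q≤p a b) h)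
    pick (inj₂ e) = subst (λ z → a ⊓ b < z + r) (sym e) (ℚₚ.≤-<-trans (ℚₚ.p⊓q≤q a b) k)

  ⊓-close : ∀ {a b c d r} → ∣ a - c ∣ < r → ∣ b - d ∣ < r → ∣ (a ⊓ b) - (c ⊓ d) ∣ < r
  ⊓-close {a} {b} {c} {d} {r} h k = <⇒∣-∣< {a ⊓ b} {c ⊓ d}
    (⊓-below {a} {b} {c} {d} (∣-∣<⇒< {a} {c} h) (∣-∣<⇒< {b} {d} k))
    (⊓-below {c} {d} {a} {b} (∣-∣<⇒< {c} {a} (subst (_< r) (∣p-q∣≡∣q-p∣ a c) h))
                             (∣-∣<⇒< {d} {b} (subst (_< r) (∣p-q∣≡∣q-p∣ b d) k)))

_⊓ℝ_ : ℝ → ℝ → ℝ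
mkℝ x xc ⊓ℝ mkℝ y yc = mkℝ (λ n → x n ⊓ y n) λ ε 0<ε →
  let M , f = xc ε 0<ε
      N , g = yc ε 0<ε
  in M ℕ.⊔ N , λ m n p q → ⊓-close {x m} {y m} {x n} {y n}
    (f m n (⊔-left p) (⊔-left q)) (g m n (⊔-right {M} p) (⊔-right {M} q))

-- The value at 0 is irrelevant: a sequence apart from 0 is eventually nonzero.
recip : ℚ → ℚ
recip q with q ℚₚ.≟ 0ℚ
... | yes _  = 0ℚ
... | no q≢0 = (1/ q) {{≢-nonZero q≢0}}

private
  *-recip : ∀ {q δ} → 0ℚ < δ → δ ≤ ∣ q ∣ → q * recip q ≡ 1ℚ
  *-recip {q} 0<δ h with q ℚₚ.≟ 0ℚ
  ... | yes refl = contradiction (ℚₚ.<-≤-trans 0<δ h) (ℚₚ.<-irrefl refl)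
  ... | no q≢0   = ℚₚ.*-inverseʳ q {{≢-nonZero q≢0}}

  recip-bound : ∀ {q δ D} → 0ℚ < δ → δ * D ≡ 1ℚ → δ ≤ ∣ q ∣ → ∣ recip q ∣ ≤ D
  recip-bound {q} {δ} {D} 0<δ e h = ℚₚ.*-cancelˡ-≤-pos δ {{positive 0<δ}} (begin
    δ * ∣ recip q ∣     ≤⟨ 0≤⇒*-mono (ℚₚ.<⇒≤ 0<δ) h (ℚₚ.0≤∣p∣ (recip q)) ℚₚ.≤-refl ⟩
    ∣ q ∣ * ∣ recip q ∣ ≡⟨ ℚₚ.∣p*q∣≡∣p∣*∣q∣ q (recip q) ⟨
    ∣ q * recip q ∣     ≡⟨ cong ∣_∣ (*-recip {q} 0<δ h) ⟩
    1ℚ                  ≡⟨ e ⟨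
    δ * D               ∎)

  recip-close : ∀ {a b δ D r} → 0ℚ < δ → 0ℚ < D → δ * D ≡ 1ℚ → δ ≤ ∣ a ∣ → δ ≤ ∣ b ∣ →
                ∣ a - b ∣ < r → ∣ recip a - recip b ∣ < (D * D) * r
  recip-close {a} {b} {δ} {D} {r} 0<δ 0<D e δ≤a δ≤b h = begin-strict
    ∣ s - t ∣
      ≡⟨ cong ∣_∣ (cong₂ _-_ (sym (trans (cong (s *_) (*-recip {b} 0<δ δ≤b)) (ℚₚ.*-identityʳ s)))
                            (sym (trans (cong (t *_) (*-recip {a} 0<δ δ≤a)) (ℚₚ.*-identityʳ t)))) ⟩
    ∣ s * (b * t) - t * (a * s) ∣
      ≡⟨ cong ∣_∣ (regroup a b s t) ⟩
    ∣ (s * t) * (b - a) ∣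
      ≡⟨ trans (ℚₚ.∣p*q∣≡∣p∣*∣q∣ (s * t) (b - a)) (cong (_* ∣ b - a ∣) (ℚₚ.∣p*q∣≡∣p∣*∣q∣ s t)) ⟩
    (∣ s ∣ * ∣ t ∣) * ∣ b - a ∣
      ≤⟨ ℚₚ.*-monoʳ-≤-nonNeg ∣ b - a ∣ {{nonNegative (ℚₚ.0≤∣p∣ (b - a))}}
           (0≤⇒*-mono (ℚₚ.0≤∣p∣ s) (recip-bound {a} 0<δ e δ≤a) (ℚₚ.0≤∣p∣ t) (recip-bound {b} 0<δ e δ≤b)) ⟩
    (D * D) * ∣ b - a ∣
      <⟨ ℚₚ.*-monoʳ-<-pos (D * D) {{positive (0<* 0<D 0<D)}} (subst (_< r) (∣p-q∣≡∣q-p∣ a b) h) ⟩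
    (D * D) * r ∎
    where
    s = recip a
    t = recip b
    regroup : ∀ a b s t → s * (b * t) - t * (a * s) ≡ (s * t) * (b - a)
    regroup = solve 4 (λ a b s t → s :* (b :* t) :- t :* (a :* s) := (s :* t) :* (b :- a)) refl

1/ℝ : (y : ℝ) → y #0 → ℝ
1/ℝ (mkℝ y yc) (δ , 0<δ , K , f) = mkℝ (λ n → recip (y n)) λ ε 0<ε →
  let D , 0<D , δD≡1 = scale δ 0<δ 1ℚ 0<1
      η , 0<η , e = scale (D * D) (0<* 0<D 0<D) ε 0<ε
      N , g = yc η 0<η
  in K ℕ.⊔ N , λ m n p q → subst (_ <_) e
    (recip-close {y m} {y n} 0<δ 0<D δD≡1 (f m (⊔-left p)) (f n (⊔-left q))
      (g m n (⊔-right {K} p) (⊔-right {K} q)))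

divℝ : ℝ → (y : ℝ) → y #0 → ℝ
divℝ x y y#0 = x *ℝ 1/ℝ y y#0

syntax divℝ x y y#0 = x /ℝ y [ y#0 ]

1/ℝ-inverse : ∀ y (y#0 : y #0) → y *ℝ 1/ℝ y y#0 ≃ℝ fromℕℝ 1
1/ℝ-inverse y (δ , 0<δ , K , f) ε 0<ε = K , λ n K≤n → subst (λ z → ∣ z - 1ℚ ∣ < ε)
  (sym (*-recip {seq y n} 0<δ (f n K≤n))) 0<ε

cube : ℕ → ℕ
cube c = c ℕ.* c ℕ.* c

-- ⌊ ∛ m ⌋
icbrt : ℕ → ℕ
icbrt zero = 0
icbrt (suc m) with cube (suc (icbrt m)) ℕₚ.≤? suc m
... | yes _ = suc (icbrt m)
... | no  _ = icbrt m

cube-mono : ∀ {a b} → a ℕ.≤ b → cube a ℕ.≤ cube b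
cube-mono h = ℕₚ.*-mono-≤ (ℕₚ.*-mono-≤ h h) h

cube-strict : ∀ a → cube a ℕ.< cube (suc a)
cube-strict a = ℕₚ.*-mono-< (ℕₚ.*-mono-< (ℕₚ.n<1+n a) (ℕₚ.n<1+n a)) (ℕₚ.n<1+n a)

icbrt-spec : ∀ m → cube (icbrt m) ℕ.≤ m × m ℕ.< cube (suc (icbrt m))
icbrt-spec zero = z≤n , s≤s z≤n
icbrt-spec (suc m) with icbrt-spec m | cube (suc (icbrt m)) ℕₚ.≤? suc m
... | lo , hi | yes p = p , ℕₚ.≤-<-trans hi (cube-strict (suc (icbrt m)))
... | lo , hi | no ¬p = ℕₚ.m≤n⇒m≤1+n lo , ℕₚ.≰⇒> ¬p

-- ⌊ k ∛ Δ ⌋ / k  with  k = n + 1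
cbrtSeq : ℕ → ℕ → ℚ
cbrtSeq Δ n = + icbrt (Δ ℕ.* cube (suc n)) / suc n

toℚᵘ-/ : ∀ c k → toℚᵘ (+ c / suc k) ℚᵘ.≃ ℚᵘ.mkℚᵘ (+ c) k
toℚᵘ-/ c k = ℚₚ.toℚᵘ-fromℚᵘ (ℚᵘ.mkℚᵘ (+ c) k)

/*ι : ∀ c k → (+ c / suc k) * ι (suc k) ≡ ι c
/*ι c k = ℚₚ.toℚᵘ-injective (ℚᵘₚ.≃-trans (ℚₚ.toℚᵘ-homo-* (+ c / suc k) (ι (suc k)))
  (ℚᵘₚ.≃-trans (ℚᵘₚ.*-cong (toℚᵘ-/ c k) (toℚᵘ-/ (suc k) 0))
  (ℚᵘₚ.≃-trans (ℚᵘ.*≡* (trans (ℤₚ.*-identityʳ _) (cong (λ z → + c ℤ.* + z) (sym (ℕₚ.*-identityʳ (suc k))))))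
    (ℚᵘₚ.≃-sym (toℚᵘ-/ c 0)))))

ι-* : ∀ a b → ι (a ℕ.* b) ≡ ι a * ι b
ι-* a b = ℚₚ.toℚᵘ-injective (ℚᵘₚ.≃-trans (toℚᵘ-/ (a ℕ.* b) 0) (ℚᵘₚ.≃-sym
  (ℚᵘₚ.≃-trans (ℚₚ.toℚᵘ-homo-* (ι a) (ι b))
  (ℚᵘₚ.≃-trans (ℚᵘₚ.*-cong (toℚᵘ-/ a 0) (toℚᵘ-/ b 0))
    (ℚᵘ.*≡* (cong (ℤ._* + 1) (sym (ℤₚ.pos-* a b))))))))

ι-+ : ∀ a b → ι (a ℕ.+ b) ≡ ι a + ι b
ι-+ a b = ℚₚ.toℚᵘ-injective (ℚᵘₚ.≃-trans (toℚᵘ-/ (a ℕ.+ b) 0) (ℚᵘₚ.≃-sym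
  (ℚᵘₚ.≃-trans (ℚₚ.toℚᵘ-homo-+ (ι a) (ι b))
  (ℚᵘₚ.≃-trans (ℚᵘₚ.+-cong (toℚᵘ-/ a 0) (toℚᵘ-/ b 0))
    (ℚᵘ.*≡* (cong (ℤ._* + 1) (cong₂ ℤ._+_ (ℤₚ.*-identityʳ (+ a)) (ℤₚ.*-identityʳ (+ b)))))))))

ι-mono-≤ : ∀ {a b} → a ℕ.≤ b → ι a ≤ ι b
ι-mono-≤ {a} {b} h = ℚₚ.toℚᵘ-cancel-≤ (ℚᵘₚ.≤-respˡ-≃ (ℚᵘₚ.≃-sym (toℚᵘ-/ a 0))
  (ℚᵘₚ.≤-respʳ-≃ (ℚᵘₚ.≃-sym (toℚᵘ-/ b 0)) (ℚᵘ.*≤* (ℤₚ.*-monoʳ-≤-nonNeg (+ 1) (ℤ.+≤+ h)))))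

ι-mono-< : ∀ {a b} → a ℕ.< b → ι a < ι b
ι-mono-< {a} {b} h = ℚₚ.toℚᵘ-cancel-< (ℚᵘₚ.<-respˡ-≃ (ℚᵘₚ.≃-sym (toℚᵘ-/ a 0))
  (ℚᵘₚ.<-respʳ-≃ (ℚᵘₚ.≃-sym (toℚᵘ-/ b 0)) (ℚᵘ.*<* (ℤₚ.*-monoʳ-<-pos (+ 1) (ℤ.+<+ h)))))

0<ι : ∀ k → 0ℚ < ι (suc k)
0<ι k = ι-mono-< {0} {suc k} (s≤s z≤n)

0<ι-cube : ∀ n → 0ℚ < ι (cube (suc n))
0<ι-cube n = ι-mono-< {0} {cube (suc n)} (s≤s z≤n)

step : ℕ → ℚ
step n = + 1 / suc n

cubeℚ : ℚ → ℚ
cubeℚ p = p * p * p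

ι-cube : ∀ c → ι (cube c) ≡ cubeℚ (ι c)
ι-cube c = trans (ι-* (c ℕ.* c) c) (cong (_* ι c) (ι-* c c))

0≤/ : ∀ c k → 0ℚ ≤ + c / suc k
0≤/ c k = ℚₚ.*-cancelʳ-≤-pos (ι (suc k)) {{positive (0<ι k)}}
  (subst₂ _≤_ (sym (ℚₚ.*-zeroˡ (ι (suc k)))) (sym (/*ι c k)) (ι-mono-≤ {0} {c} z≤n))

0≤* : ∀ {p q} → 0ℚ ≤ p → 0ℚ ≤ q → 0ℚ ≤ p * q
0≤* {p} {q} 0≤p 0≤q = subst (_≤ p * q) (ℚₚ.*-zeroˡ q)
  (ℚₚ.*-monoʳ-≤-nonNeg q {{nonNegative 0≤q}} 0≤p)

cubeℚ-mono : ∀ {p q} → 0ℚ ≤ p → p ≤ q → cubeℚ p ≤ cubeℚ q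
cubeℚ-mono {p} {q} 0≤p h = 0≤⇒*-mono {p * p} {q * q} {p} {q}
  (0≤* {p} {p} 0≤p 0≤p) (0≤⇒*-mono {p} {q} {p} {q} 0≤p h 0≤p h) 0≤p h

cubeℚ-cancel-< : ∀ {p q} → 0ℚ ≤ q → cubeℚ p < cubeℚ q → p < q
cubeℚ-cancel-< {p} {q} 0≤q h = ℚₚ.≰⇒> λ q≤p → ℚₚ.<-irrefl refl (ℚₚ.<-≤-trans h (cubeℚ-mono {q} {p} 0≤q q≤p))

cubeℚ-* : ∀ p q → cubeℚ (p * q) ≡ cubeℚ p * cubeℚ q
cubeℚ-* = solve 2 (λ p q → p :* q :* (p :* q) :* (p :* q) := (p :* p :* p) :* (q :* q :* q)) refl

cbrtSeq-lower : ∀ Δ n → cubeℚ (cbrtSeq Δ n) ≤ + Δ / 1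
cbrtSeq-lower Δ n = ℚₚ.*-cancelʳ-≤-pos (ι (cube (suc n))) {{positive (0<ι-cube n)}} (begin
  cubeℚ x * ι (cube (suc n)) ≡⟨ cong (cubeℚ x *_) (ι-cube (suc n)) ⟩
  cubeℚ x * cubeℚ (ι (suc n)) ≡⟨ cubeℚ-* x (ι (suc n)) ⟨
  cubeℚ (x * ι (suc n))      ≡⟨ cong cubeℚ (/*ι c n) ⟩
  cubeℚ (ι c)                ≡⟨ ι-cube c ⟨
  ι (cube c)                 ≤⟨ ι-mono-≤ (proj₁ (icbrt-spec (Δ ℕ.* cube (suc n)))) ⟩
  ι (Δ ℕ.* cube (suc n))     ≡⟨ ι-* Δ (cube (suc n)) ⟩
  ι Δ * ι (cube (suc n))     ∎)
  where
  x = cbrtSeq Δ n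
  c = icbrt (Δ ℕ.* cube (suc n))

cbrtSeq-upper : ∀ Δ n → + Δ / 1 < cubeℚ (cbrtSeq Δ n + step n)
cbrtSeq-upper Δ n = ℚₚ.*-cancelʳ-<-nonNeg (ι (cube (suc n))) {{nonNegative (ℚₚ.<⇒≤ (0<ι-cube n))}} (begin-strict
  ι Δ * ι (cube (suc n))     ≡⟨ ι-* Δ (cube (suc n)) ⟨
  ι (Δ ℕ.* cube (suc n))     <⟨ ι-mono-< (proj₂ (icbrt-spec (Δ ℕ.* cube (suc n)))) ⟩
  ι (cube (suc c))           ≡⟨ ι-cube (suc c) ⟩
  cubeℚ (ι (suc c))          ≡⟨ cong cubeℚ (trans (ι-+ 1 c) (ℚₚ.+-comm (ι 1) (ι c))) ⟩
  cubeℚ (ι c + ι 1)          ≡⟨ cong cubeℚ (cong₂ _+_ (/*ι c n) (/*ι 1 n)) ⟨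
  cubeℚ (x * ι (suc n) + step n * ι (suc n)) ≡⟨ cong cubeℚ (ℚₚ.*-distribʳ-+ (ι (suc n)) x (step n)) ⟨
  cubeℚ ((x + step n) * ι (suc n)) ≡⟨ cubeℚ-* (x + step n) (ι (suc n)) ⟩
  cubeℚ (x + step n) * cubeℚ (ι (suc n)) ≡⟨ cong (cubeℚ (x + step n) *_) (ι-cube (suc n)) ⟨
  cubeℚ (x + step n) * ι (cube (suc n)) ∎)
  where
  x = cbrtSeq Δ n
  c = icbrt (Δ ℕ.* cube (suc n))

0≤cbrtSeq : ∀ Δ n → 0ℚ ≤ cbrtSeq Δ n
0≤cbrtSeq Δ n = 0≤/ (icbrt (Δ ℕ.* cube (suc n))) n

0≤cbrtSeq+step : ∀ Δ n → 0ℚ ≤ cbrtSeq Δ n + step n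
0≤cbrtSeq+step Δ n = ℚₚ.+-mono-≤ (0≤cbrtSeq Δ n) (0≤/ 1 n)

cbrtSeq-< : ∀ Δ m n → cbrtSeq Δ m < cbrtSeq Δ n + step n
cbrtSeq-< Δ m n = cubeℚ-cancel-< (0≤cbrtSeq+step Δ n)
  (ℚₚ.≤-<-trans (cbrtSeq-lower Δ m) (cbrtSeq-upper Δ n))

step-small : ∀ ε → 0ℚ < ε → ∃ λ N → ∀ n → N ℕ.≤ n → step n < ε
step-small (mkℚ +[1+ a ] d _) _ = suc d , λ n d<n →
  ℚₚ.toℚᵘ-cancel-< (ℚᵘₚ.<-respˡ-≃ (ℚᵘₚ.≃-sym (toℚᵘ-/ 1 n))
    (ℚᵘ.*<* (subst (ℤ._< + (suc a ℕ.* suc n)) (sym (ℤₚ.*-identityˡ (+ suc d)))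
      (ℤ.+<+ (ℕₚ.<-≤-trans (s≤s d<n) (ℕₚ.m≤n*m (suc n) (suc a)))))))
step-small (mkℚ +0 _ _)       (*<* (ℤ.+<+ ()))
step-small (mkℚ -[1+ _ ] _ _) (*<* ())

cbrt : ℕ → ℝ
cbrt Δ = mkℝ (cbrtSeq Δ) λ ε 0<ε →
  let N , f = step-small ε 0<ε
  in N , λ m n p q → <⇒∣-∣< {cbrtSeq Δ m} {cbrtSeq Δ n}
    (ℚₚ.<-trans (cbrtSeq-< Δ m n) (ℚₚ.+-monoʳ-< (cbrtSeq Δ n) (f n q)))
    (ℚₚ.<-trans (cbrtSeq-< Δ n m) (ℚₚ.+-monoʳ-< (cbrtSeq Δ m) (f m p)))

infix 8 _^[_/3]
_^[_/3] : ℕ → ℕ → ℝ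
Δ ^[ p /3] = cbrt Δ ^ℝ p

cube-gap : ∀ {x h B} → 0ℚ ≤ x → 0ℚ ≤ h → x + h ≤ B →
           cubeℚ (x + h) ≤ cubeℚ x + (B * B + B * B + B * B) * h
cube-gap {x} {h} {B} 0≤x 0≤h y≤B = begin
  cubeℚ y ≡⟨ expand x h ⟩
  cubeℚ x + (x * x + x * y + y * y) * h
    ≤⟨ ℚₚ.+-monoʳ-≤ (cubeℚ x) (ℚₚ.*-monoʳ-≤-nonNeg h {{nonNegative 0≤h}}
         (ℚₚ.+-mono-≤ (ℚₚ.+-mono-≤ (0≤⇒*-mono 0≤x x≤B 0≤x x≤B) (0≤⇒*-mono 0≤x x≤B 0≤y y≤B))
                      (0≤⇒*-mono 0≤y y≤B 0≤y y≤B))) ⟩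
  cubeℚ x + (B * B + B * B + B * B) * h ∎
  where
  y = x + h
  0≤y : 0ℚ ≤ x + h
  0≤y = ℚₚ.+-mono-≤ 0≤x 0≤h
  x≤B : x ≤ B
  x≤B = ℚₚ.≤-trans (subst (_≤ x + h) (ℚₚ.+-identityʳ x) (ℚₚ.+-monoʳ-≤ x 0≤h)) y≤B
  expand : ∀ x h → (x + h) * (x + h) * (x + h) ≡
                   x * x * x + (x * x + x * (x + h) + (x + h) * (x + h)) * h
  expand = solve 2 (λ x h → (x :+ h) :* (x :+ h) :* (x :+ h) :=
                   x :* x :* x :+ (x :* x :+ x :* (x :+ h) :+ (x :+ h) :* (x :+ h)) :* h) refl

cbrtSeq-bound : ∀ Δ n → cbrtSeq Δ n + step n ≤ ι (suc Δ) + 1ℚ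
cbrtSeq-bound Δ n = ℚₚ.+-mono-≤ {cbrtSeq Δ n} {ι (suc Δ)} {step n} {1ℚ}
  (ℚₚ.<⇒≤ (cubeℚ-cancel-< {cbrtSeq Δ n} {ι (suc Δ)} (ℚₚ.<⇒≤ (0<ι Δ)) (begin-strict
    cubeℚ (cbrtSeq Δ n) ≤⟨ cbrtSeq-lower Δ n ⟩
    ι Δ                 <⟨ ι-mono-< {Δ} {suc Δ ℕ.* (suc Δ ℕ.* suc Δ)} (ℕₚ.m≤m*n (suc Δ) (suc Δ ℕ.* suc Δ)) ⟩
    ι (suc Δ ℕ.* (suc Δ ℕ.* suc Δ)) ≡⟨ cong ι (ℕₚ.*-assoc (suc Δ) (suc Δ) (suc Δ)) ⟨
    ι (cube (suc Δ))    ≡⟨ ι-cube (suc Δ) ⟩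
    cubeℚ (ι (suc Δ))   ∎)))
  (ℚₚ.*-cancelʳ-≤-pos (ι (suc n)) {{positive (0<ι n)}} (begin
    step n * ι (suc n)  ≡⟨ /*ι 1 n ⟩
    ι 1                 ≤⟨ ι-mono-≤ {1} {suc n} (s≤s z≤n) ⟩
    ι (suc n)           ≡⟨ ℚₚ.*-identityˡ (ι (suc n)) ⟨
    1ℚ * ι (suc n)      ∎))

cbrt-cubed : ∀ Δ → Δ ^[ 3 /3] ≃ℝ fromℕℝ Δ
cbrt-cubed Δ ε 0<ε =
  let B = ι (suc Δ) + 1ℚ
      0<B = ℚₚ.+-mono-< (0<ι Δ) 0<1
      K = B * B + B * B + B * B
      0<B² = 0<* 0<B 0<B
      0<K = ℚₚ.+-mono-< (ℚₚ.+-mono-< 0<B² 0<B²) 0<B²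
      η , 0<η , Kη≡ε = scale K 0<K ε 0<ε
      N , f = step-small η 0<η
  in N , λ n N≤n →
  let x = cbrtSeq Δ n
      upper : ι Δ < cubeℚ x + ε
      upper = begin-strict
        ι Δ                  <⟨ cbrtSeq-upper Δ n ⟩
        cubeℚ (x + step n)   ≤⟨ cube-gap (0≤cbrtSeq Δ n) (0≤/ 1 n) (cbrtSeq-bound Δ n) ⟩
        cubeℚ x + K * step n <⟨ ℚₚ.+-monoʳ-< (cubeℚ x) (ℚₚ.*-monoʳ-<-pos K {{positive 0<K}} (f n N≤n)) ⟩
        cubeℚ x + K * η      ≡⟨ cong (λ z → cubeℚ x + z) Kη≡ε ⟩
        cubeℚ x + ε          ∎
      lower : cubeℚ x < ι Δ + ε
      lower = ℚₚ.≤-<-trans (cbrtSeq-lower Δ n)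
        (subst (_< ι Δ + ε) (ℚₚ.+-identityʳ (ι Δ)) (ℚₚ.+-monoʳ-< (ι Δ) 0<ε))
  in subst (λ z → ∣ z - ι Δ ∣ < ε)
    (trans (ℚₚ.*-assoc x x x) (cong (λ z → x * (x * z)) (sym (ℚₚ.*-identityʳ x))))
    (<⇒∣-∣< {cubeℚ x} {ι Δ} lower upper)

private
  lit< : ∀ p q → {_ : True (p ℚₚ.<? q)} → p < q
  lit< p q {w} = toWitness w

  large : ∀ {x h D} → ι 24 ≤ D → D < cubeℚ (x + h) → 0ℚ ≤ x + h → h < + 1 / 4 →
          1ℚ ≤ ∣ x * (x * 1ℚ) + (- ι 4) ∣
  large {x} {h} {D} 24≤D D< 0≤x+h h< = ℚₚ.≤-trans
    (ℚₚ.+-monoˡ-≤ (- ι 4) (begin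
      + 5 / 1                 ≤⟨ ℚₚ.<⇒≤ (lit< (+ 5 / 1) ((+ 9 / 4) * (+ 9 / 4))) ⟩
      (+ 9 / 4) * (+ 9 / 4)   ≤⟨ 0≤⇒*-mono 0≤9/4 9/4≤x 0≤9/4 9/4≤x ⟩
      x * x                   ≡⟨ cong (x *_) (ℚₚ.*-identityʳ x) ⟨
      x * (x * 1ℚ)            ∎))
    (p≤∣p∣ (x * (x * 1ℚ) + (- ι 4)))
    where
    0≤9/4 : 0ℚ ≤ + 9 / 4
    0≤9/4 = ℚₚ.<⇒≤ (lit< 0ℚ (+ 9 / 4))
    5/2<x+h : + 5 / 2 < x + h
    5/2<x+h = cubeℚ-cancel-< 0≤x+h (ℚₚ.<-trans (lit< (cubeℚ (+ 5 / 2)) (ι 24)) (ℚₚ.≤-<-trans 24≤D D<))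
    9/4≤x : + 9 / 4 ≤ x
    9/4≤x = ℚₚ.≮⇒≥ λ x<9/4 → ℚₚ.<-asym 5/2<x+h (ℚₚ.+-mono-< x<9/4 h<)

Δ^⅔-4#0 : ∀ {Δ} → 24 ℕ.≤ Δ → (Δ ^[ 2 /3] -ℝ fromℕℝ 4) #0
Δ^⅔-4#0 {Δ} 24≤Δ = 1ℚ , 0<1 ,
  let N , f = step-small (+ 1 / 4) (lit< 0ℚ (+ 1 / 4))
  in N , λ n N≤n → large {cbrtSeq Δ n} {step n} (ι-mono-≤ 24≤Δ) (cbrtSeq-upper Δ n)
    (0≤cbrtSeq+step Δ n) (f n N≤n)

{-# OPTIONS --safe #-}
module Submission where

-- A counting argument in the style of Rosenfeld.  Let A(X) be the number of
-- colourings of the vertex set X with k colours that are proper and contain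
-- no two-coloured cycle.  By induction on X, colouring one more vertex v
-- multiplies A(X) by at least some β < k: of the k colours offered to v, one
-- discards
--   * those of its at most Δ neighbours;
--   * those of the vertices having more than D common neighbours with v; as
--     v starts at most Δ² walks of length two, there are few of them;
--   * those closing a two-coloured cycle of length 2m.  Two adjacent vertices
--     of such a cycle determine the colours of the other 2m − 2, so by the
--     induction hypothesis the cycle costs β^-(2m−3) colours on average.  By
--     the previous point, only cycles whose vertices at distance two from v
--     have at most D common neighbours with v matter; twice their number is
--     at most D Δ^(2m−2).
-- With x = Δ^(1/3), D ≈ x² and β = D(D+1)/2 the vertices with large codegree
-- and the 4-cycles cost x⁴ together, and the longer cycles O(x²).

open import Defs
import Data.Nat.Base as ℕ
import Data.Nat.Properties as ℕₚ
import Data.Rational.Base as ℚ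
import Data.Rational.Properties as ℚₚ
open import Data.Nat.Base using (ℕ; zero; suc)
open import Data.Product.Base using (∃; _×_; _,_; proj₁; proj₂)
open import Data.Sum.Base using (_⊎_; inj₁; inj₂) renaming (map to map⊎; swap to swap⊎)
open import Function.Base using (_∘_; id)
open import Relation.Binary.PropositionalEquality
open import Relation.Nullary using (¬_; Dec; yes; no; contradiction; ¬?; _×-dec_; _⊎-dec_)
open import Relation.Nullary.Decidable using (map′; toWitness)

-- Rational estimates for the approximants of Δ^(1/3).

module CubeRoot where
  open import Data.Integer.Base using (+_)
  open import Data.Rational.Base
  open import Data.Rational.Properties
  open import Data.Rational.Solver using (module +-*-Solver)
  open +-*-Solver using (solve; con; _:+_; _:*_; _:-_; :-_; _:=_)
  open ≤-Reasoning

  *-mono-≤-nonNeg : ∀ {p q r s} → 0ℚ ≤ p → 0ℚ ≤ s → p ≤ q → r ≤ s → p * r ≤ q * s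
  *-mono-≤-nonNeg {p} {q} {r} {s} 0≤p 0≤s p≤q r≤s = ≤-trans
    (*-monoˡ-≤-nonNeg p {{nonNegative 0≤p}} r≤s) (*-monoʳ-≤-nonNeg s {{nonNegative 0≤s}} p≤q)

  ∣p-q∣<r⇒q<p+r : ∀ {p q r} → ∣ p - q ∣ < r → q < p + r
  ∣p-q∣<r⇒q<p+r {p} {q} {r} h = begin-strict
    q                ≡⟨ solve 2 (λ p q → q := p :+ :- (p :- q)) refl p q ⟩
    p + - (p - q)    ≤⟨ +-monoʳ-≤ p (bound (∣p∣≡p∨∣p∣≡-p (p - q))) ⟩
    p + ∣ p - q ∣    <⟨ +-monoʳ-< p h ⟩
    p + r            ∎
    where
    bound : _ → - (p - q) ≤ ∣ p - q ∣
    bound (inj₂ e) = ≤-reflexive (sym e)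
    bound (inj₁ e) = ≤-trans (neg-antimono-≤ (∣p∣≡p⇒0≤p e)) (0≤∣p∣ (p - q))

  -- The strict inequality between integers leaves room 1. If Q = q³ satisfies Q ≤ Δ < Q + ε with ε
  -- = 1/(2Δ), then Δ² < Q² + 2Δε = Q² + 1, so b³ < (q²)³. Hence `b` can stand for Δ^(2/3) in every
  -- late term of the sequences, without an error term.
  cbrtSeq²-lower : ∀ {b Δ} → cube b ℕ.< Δ ℕ.* Δ →
                   ∃ λ N → ∀ n → N ℕ.≤ n → ι b ≤ cbrtSeq Δ n * cbrtSeq Δ n
  cbrtSeq²-lower {b} {Δ@(suc m)} h =
    let N , close = cbrt-cubed Δ ε 0<ε
    in N , λ n N≤n → bound n (∣p-q∣<r⇒q<p+r {Q n} (close n N≤n))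
    where
    d = ι Δ
    -- `suc e` computes to `2 * Δ`, so `step e` is 1/(2Δ).
    e = m ℕ.+ 1 ℕ.* suc m
    ε = step e
    dε : ι (2 ℕ.* Δ) * ε ≡ 1ℚ
    dε = trans (*-comm (ι (2 ℕ.* Δ)) ε) (/*ι 1 e)
    0<ε : 0ℚ < ε
    0<ε = *-cancelʳ-<-nonNeg (ι (2 ℕ.* Δ)) {{nonNegative (<⇒≤ (0<ι e))}}
      (subst₂ _<_ (sym (*-zeroˡ (ι (2 ℕ.* Δ)))) (sym (/*ι 1 e)) (0<ι 0))
    Q : ℕ → ℚ
    Q n = seq (Δ ^[ 3 /3]) n
    bound : ∀ n → d < Q n + ε → ι b ≤ cbrtSeq Δ n * cbrtSeq Δ n
    bound n d<Q+ε = <⇒≤ (cubeℚ-cancel-< (0≤* 0≤q 0≤q) (+-cancelʳ-<′ 1ℚ (begin-strict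
      cubeℚ (ι b) + 1ℚ           ≡⟨ cong (_+ 1ℚ) (ι-cube b) ⟨
      ι (cube b) + ι 1           ≡⟨ ι-+ (cube b) 1 ⟨
      ι (cube b ℕ.+ 1)           ≤⟨ ι-mono-≤ (ℕₚ.≤-trans (ℕₚ.≤-reflexive (ℕₚ.+-comm (cube b) 1)) h) ⟩
      ι (Δ ℕ.* Δ)                ≡⟨ ι-* Δ Δ ⟩
      d * d                      <⟨ *-monoʳ-<-pos d {{positive (0<ι m)}} d<Q+ε ⟩
      d * (Q n + ε)              ≡⟨ solve 3 (λ d Q ε → d :* (Q :+ ε) := d :* Q :+ d :* ε) refl d (Q n) ε ⟩
      d * Q n + d * ε            ≤⟨ +-monoˡ-≤ (d * ε) (*-mono-≤-nonNeg (<⇒≤ (0<ι m)) 0≤Q (<⇒≤ d<Q+ε) ≤-refl) ⟩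
      (Q n + ε) * Q n + d * ε    ≡⟨ solve 3 (λ d Q ε → (Q :+ ε) :* Q :+ d :* ε := Q :* Q :+ (Q :* ε :+ d :* ε)) refl d (Q n) ε ⟩
      Q n * Q n + (Q n * ε + d * ε) ≤⟨ +-monoʳ-≤ (Q n * Q n) (+-monoˡ-≤ (d * ε) (*-monoʳ-≤-nonNeg ε {{nonNegative (<⇒≤ 0<ε)}} Q≤d)) ⟩
      Q n * Q n + (d * ε + d * ε) ≡⟨ cong (_+_ (Q n * Q n)) (trans (solve 2 (λ d ε → d :* ε :+ d :* ε := con (ι 2) :* d :* ε) refl d ε)
                                      (trans (cong (_* ε) (sym (ι-* 2 Δ))) dε)) ⟩
      Q n * Q n + 1ℚ             ≡⟨ cong (_+ 1ℚ) (solve 1 (λ q → q :* (q :* (q :* con 1ℚ)) :* (q :* (q :* (q :* con 1ℚ))) :=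
                                      q :* q :* (q :* q) :* (q :* q)) refl (cbrtSeq Δ n)) ⟩
      cubeℚ (cbrtSeq Δ n * cbrtSeq Δ n) + 1ℚ ∎)))
      where
      q = cbrtSeq Δ n
      0≤q : 0ℚ ≤ q
      0≤q = 0≤cbrtSeq Δ n
      Q≡q³ : Q n ≡ cubeℚ q
      Q≡q³ = solve 1 (λ q → q :* (q :* (q :* con 1ℚ)) := q :* q :* q) refl q
      0≤Q : 0ℚ ≤ Q n
      0≤Q = ≤-trans (0≤* (0≤* 0≤q 0≤q) 0≤q) (≤-reflexive (sym Q≡q³))
      Q≤d : Q n ≤ d
      Q≤d = ≤-trans (≤-reflexive Q≡q³) (cbrtSeq-lower Δ n)
      +-cancelʳ-<′ : ∀ r {x y} → x + r < y + r → x < y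
      +-cancelʳ-<′ r {x} {y} h = ≰⇒> λ y≤x → <-irrefl refl (<-≤-trans h (+-monoˡ-≤ r y≤x))

  *-recip : ∀ {q} → 0ℚ < q → q * recip q ≡ 1ℚ
  *-recip {q} 0<q with q ≟ 0ℚ
  ... | yes refl = contradiction 0<q (<-irrefl refl)
  ... | no q≢0   = *-inverseʳ q {{≢-nonZero q≢0}}

  0≤recip : ∀ {q} → 0ℚ < q → 0ℚ ≤ recip q
  0≤recip {q} 0<q = *-cancelˡ-≤-pos q {{positive 0<q}} (≤-trans (≤-reflexive (*-zeroʳ q))
    (≤-trans (<⇒≤ (0<ι 0)) (≤-reflexive (sym (*-recip 0<q)))))

  module _ (q : ℚ) where

    private
      p = q * q
      q⁴ = q * (q * (q * (q * 1ℚ)))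

    q⁴≡p² : q⁴ ≡ p * p
    q⁴≡p² = solve 1 (λ q → q :* (q :* (q :* (q :* con 1ℚ))) := q :* q :* (q :* q)) refl q

    fourth-power-lower : ∀ {b} → ι b ≤ p → ι b * ι b ≤ q⁴
    fourth-power-lower {b} h = ≤-trans (*-mono-≤-nonNeg 0≤ιb (≤-trans 0≤ιb h) h h) (≤-reflexive (sym q⁴≡p²))
      where
      0≤ιb : 0ℚ ≤ ι b
      0≤ιb = ι-mono-≤ {0} {b} ℕ.z≤n

    -- With p = q², the quotient 8p²/(p - 4) is at least 8p because 0 < p - 4 ≤ p; positivity comes
    -- from p ≥ b ≥ 8.
    quotient-lower : ∀ {b} → 8 ℕ.≤ b → ι b ≤ p → ι 8 * ι b ≤ ι 8 * q⁴ * recip (q * (q * 1ℚ) + - ι 4)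
    quotient-lower {b} 8≤b h = begin
      ι 8 * ι b                ≤⟨ *-monoˡ-≤-nonNeg (ι 8) h ⟩
      ι 8 * p                  ≡⟨ cong (ι 8 *_) (trans (cong (p *_) (*-recip 0<y)) (*-identityʳ p)) ⟨
      ι 8 * (p * (y * recip y)) ≡⟨ cong (ι 8 *_) (sym (*-assoc p y (recip y))) ⟩
      ι 8 * (p * y * recip y)  ≤⟨ *-monoˡ-≤-nonNeg (ι 8) (*-monoʳ-≤-nonNeg (recip y) {{nonNegative (0≤recip 0<y)}}
                                    (*-monoˡ-≤-nonNeg p {{nonNegative 0≤p}} y≤p)) ⟩
      ι 8 * (p * p * recip y)  ≡⟨ trans (cong (λ z → ι 8 * (z * recip y)) (sym q⁴≡p²)) (sym (*-assoc (ι 8) q⁴ (recip y))) ⟩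
      ι 8 * q⁴ * recip y       ∎
      where
      y = q * (q * 1ℚ) + - ι 4
      y≡p-4 : y ≡ p + - ι 4
      y≡p-4 = cong (λ z → q * z + - ι 4) (*-identityʳ q)
      8≤p : ι 8 ≤ p
      8≤p = ≤-trans (ι-mono-≤ 8≤b) h
      0≤p : 0ℚ ≤ p
      0≤p = ≤-trans (<⇒≤ (0<ι 7)) 8≤p
      0<y : 0ℚ < y
      0<y = <-≤-trans (toWitness {a? = 0ℚ <? ι 8 + - ι 4} _) (≤-trans (+-monoˡ-≤ (- ι 4) 8≤p) (≤-reflexive (sym y≡p-4)))
      y≤p : y ≤ p
      y≤p = begin
        y         ≡⟨ y≡p-4 ⟩
        p + - ι 4 ≤⟨ +-monoʳ-≤ p (toWitness {a? = - ι 4 ≤? 0ℚ} _) ⟩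
        p + 0ℚ    ≡⟨ +-identityʳ p ⟩
        p         ∎

    module _ {b Δ k : ℕ} (h : ι b ≤ p) where

      private
        leading : (+ 3 / 2) * (ι b * ι b) ≤ (+ 3 / 2) * q⁴
        leading = *-monoˡ-≤-nonNeg (+ 3 / 2) (fourth-power-lower {b} h)

      -- Doubling clears the denominator of 3/2. The 30 is 2 · 14 + 2, where the 2 pays for the unit
      -- gap that will witness strictness.
      first-≤ : 2 ℕ.* k ℕ.+ 30 ℕ.≤ 3 ℕ.* (b ℕ.* b) ℕ.+ 10 ℕ.* Δ →
                ι k + 1ℚ ≤ (+ 3 / 2) * q⁴ + ι 5 * ι Δ + - ι 14
      first-≤ le = ≤-trans (*-cancelˡ-≤-pos (ι 2) (begin
        ι 2 * (ι k + 1ℚ)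
          ≡⟨ solve 1 (λ k → con (ι 2) :* (k :+ con 1ℚ) := con (ι 2) :* k :+ con (ι 30) :- con (ι 28)) refl (ι k) ⟩
        ι 2 * ι k + ι 30 - ι 28
          ≡⟨ cong (_- ι 28) (trans (ι-+ (2 ℕ.* k) 30) (cong (_+ ι 30) (ι-* 2 k))) ⟨
        ι (2 ℕ.* k ℕ.+ 30) - ι 28
          ≤⟨ +-monoˡ-≤ (- ι 28) (ι-mono-≤ le) ⟩
        ι (3 ℕ.* (b ℕ.* b) ℕ.+ 10 ℕ.* Δ) - ι 28
          ≡⟨ cong (_- ι 28) (trans (ι-+ (3 ℕ.* (b ℕ.* b)) (10 ℕ.* Δ)) (cong₂ _+_ (trans (ι-* 3 (b ℕ.* b)) (cong (ι 3 *_) (ι-* b b))) (ι-* 10 Δ))) ⟩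
        ι 3 * (ι b * ι b) + ι 10 * ι Δ - ι 28
          ≡⟨ solve 2 (λ B d → con (ι 3) :* (B :* B) :+ con (ι 10) :* d :- con (ι 28) :=
               con (ι 2) :* (con (+ 3 / 2) :* (B :* B) :+ con (ι 5) :* d :+ :- con (ι 14))) refl (ι b) (ι Δ) ⟩
        ι 2 * ((+ 3 / 2) * (ι b * ι b) + ι 5 * ι Δ + - ι 14) ∎))
        (+-monoˡ-≤ (- ι 14) (+-monoˡ-≤ (ι 5 * ι Δ) leading))

      second-≤ : 8 ℕ.≤ b → 2 ℕ.* k ℕ.≤ 3 ℕ.* (b ℕ.* b) ℕ.+ 2 ℕ.* Δ ℕ.+ 16 ℕ.* b →
                 ι k + 1ℚ ≤ (+ 3 / 2) * q⁴ + ι Δ + ι 8 * q⁴ * recip (q * (q * 1ℚ) + - ι 4) + ι 1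
      second-≤ 8≤b le = +-monoˡ-≤ (ι 1) {ι k} (≤-trans (*-cancelˡ-≤-pos {ι k} {(+ 3 / 2) * (ι b * ι b) + ι Δ + ι 8 * ι b} (ι 2) (begin
        ι 2 * ι k                                       ≡⟨ ι-* 2 k ⟨
        ι (2 ℕ.* k)                                     ≤⟨ ι-mono-≤ le ⟩
        ι (3 ℕ.* (b ℕ.* b) ℕ.+ 2 ℕ.* Δ ℕ.+ 16 ℕ.* b)
          ≡⟨ trans (ι-+ (3 ℕ.* (b ℕ.* b) ℕ.+ 2 ℕ.* Δ) (16 ℕ.* b)) (cong₂ _+_
               (trans (ι-+ (3 ℕ.* (b ℕ.* b)) (2 ℕ.* Δ)) (cong₂ _+_ (trans (ι-* 3 (b ℕ.* b)) (cong (ι 3 *_) (ι-* b b))) (ι-* 2 Δ))) (ι-* 16 b)) ⟩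
        ι 3 * (ι b * ι b) + ι 2 * ι Δ + ι 16 * ι b
          ≡⟨ solve 2 (λ B d → con (ι 3) :* (B :* B) :+ con (ι 2) :* d :+ con (ι 16) :* B :=
               con (ι 2) :* (con (+ 3 / 2) :* (B :* B) :+ d :+ con (ι 8) :* B)) refl (ι b) (ι Δ) ⟩
        ι 2 * ((+ 3 / 2) * (ι b * ι b) + ι Δ + ι 8 * ι b) ∎))
        (+-mono-≤ {(+ 3 / 2) * (ι b * ι b) + ι Δ} {(+ 3 / 2) * q⁴ + ι Δ} (+-monoˡ-≤ (ι Δ) leading) (quotient-lower {b} 8≤b h)))

import Data.Fin.Properties as Finₚ
import Data.List.Membership.DecPropositional as Membership
import Data.List.Relation.Binary.Permutation.Setoid.Properties as Permutationₛ
import Data.List.Relation.Unary.All.Properties as Allₚ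
import Data.List.Relation.Unary.Unique.Propositional.Properties as Uniqueₚ
open import Data.Empty using (⊥-elim) renaming (⊥ to Empty)
open import Data.Fin.Base using (Fin; zero; suc; inject₁; fromℕ)
open import Data.Fin.Subset using (Subset; ⊤; ⁅_⁆; _∪_; _-_; ∣_∣; inside; outside)
  renaming (_∈_ to _∈ₛ_; _∉_ to _∉ₛ_; _⊆_ to _⊆ₛ_)
open import Data.Fin.Subset.Properties
  using (_∈?_; ∈⊤; nonempty?; p─q⊆p; x∈p∧x≢y⇒x∈p-y; x∈p⇒∣p-x∣<∣p∣; x∈p∪q⁺; x∈p∪q⁻; x∈⁅x⁆; x∈⁅y⁆⇒x≡y)
open import Data.List.Base
  using (List; []; _∷_; map; length; filter; concatMap; allFin; _++_; reverse; downFrom; tabulate)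
open import Data.List.Extrema.Nat using (xs≤max)
open import Data.List.Membership.Propositional using (_∈_)
open import Data.List.Membership.Propositional.Properties
  using (∈-allFin; ∈-filter⁺; ∈-filter⁻; ∈-map⁺; ∈-concatMap⁺; ∈-∃++; ∈-downFrom⁺)
open import Data.List.Properties
  using (length-tabulate; length-map; length-++; length-filter; length-reverse; map-++; map-∘; unfold-reverse; ∷-injectiveˡ)
open import Data.List.Relation.Binary.Permutation.Propositional using (_↭_; prep; ↭-sym; ↭⇒↭ₛ)
open import Data.List.Relation.Binary.Permutation.Propositional.Properties
  using (All-resp-↭; ∈-resp-↭; ↭-reverse; ++-comm; ↭-length)
open import Data.List.Relation.Unary.All as All using (All; []; _∷_; all?)
open import Data.List.Relation.Unary.AllPairs using ([]; _∷_)
open import Data.List.Relation.Unary.Any as Any using (here; there)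
open import Data.List.Relation.Unary.Unique.DecPropositional using (unique?)
open import Data.List.Relation.Unary.Unique.Propositional using (Unique)
open import Data.Nat.Base hiding (_/_)
open import Data.Nat.ListAction using (sum)
open import Data.Nat.ListAction.Properties using (sum-++)
open import Data.Nat.Properties
open import Data.Nat.Tactic.RingSolver using (solve-∀)
open import Data.Unit.Base using (tt) renaming (⊤ to Unit)
open import Data.Vec.Base using (Vec; []; _∷_; lookup; _[_]≔_; there)
open import Data.Vec.Properties using (lookup∘updateAt; lookup∘updateAt′)
open import Relation.Unary using (Decidable)

open CubeRoot

-- Finite sums and counting.

private variable
  A B : Set

∑ : List A → (A → ℕ) → ℕ
∑ xs f = sum (map f xs)

syntax ∑ xs (λ x → e) = ∑[ x ∈ xs ] e

∑-mono : ∀ (xs : List A) {f g : A → ℕ} → (∀ {x} → x ∈ xs → f x ≤ g x) → ∑ xs f ≤ ∑ xs g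
∑-mono []       h = z≤n
∑-mono (x ∷ xs) h = +-mono-≤ (h (here refl)) (∑-mono xs (h ∘ there))

∑-cong : ∀ (xs : List A) {f g : A → ℕ} → (∀ x → f x ≡ g x) → ∑ xs f ≡ ∑ xs g
∑-cong []       h = refl
∑-cong (x ∷ xs) h = cong₂ _+_ (h x) (∑-cong xs h)

∑-+ : ∀ (xs : List A) (f g : A → ℕ) → ∑[ x ∈ xs ] (f x + g x) ≡ ∑ xs f + ∑ xs g
∑-+ []       f g = refl
∑-+ (x ∷ xs) f g = trans (cong (f x + g x +_) (∑-+ xs f g)) (exchange (f x) (g x) _ _)
  where
  exchange : ∀ a b c d → a + b + (c + d) ≡ a + c + (b + d)
  exchange = solve-∀

∑-* : ∀ (xs : List A) m (f : A → ℕ) → ∑[ x ∈ xs ] (m * f x) ≡ m * ∑ xs f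
∑-* []       m f = sym (*-zeroʳ m)
∑-* (x ∷ xs) m f = trans (cong (m * f x +_) (∑-* xs m f)) (sym (*-distribˡ-+ m (f x) _))

∑-const : ∀ (xs : List A) m → ∑[ _ ∈ xs ] m ≡ length xs * m
∑-const []       m = refl
∑-const (x ∷ xs) m = cong (m +_) (∑-const xs m)

∑-bound : ∀ (xs : List A) {f : A → ℕ} {m} → (∀ {x} → x ∈ xs → f x ≤ m) → ∑ xs f ≤ length xs * m
∑-bound xs {m = m} h = ≤-trans (∑-mono xs h) (≤-reflexive (∑-const xs m))

∑-++ : ∀ (xs ys : List A) (f : A → ℕ) → ∑ (xs ++ ys) f ≡ ∑ xs f + ∑ ys f
∑-++ xs ys f = trans (cong sum (map-++ f xs ys)) (sum-++ (map f xs) (map f ys))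

∑-map : ∀ (g : A → B) xs (f : B → ℕ) → ∑ (map g xs) f ≡ ∑ xs (f ∘ g)
∑-map g xs f = cong sum (sym (map-∘ xs))

∑-concatMap : ∀ (g : A → List B) xs (f : B → ℕ) → ∑ (concatMap g xs) f ≡ ∑[ x ∈ xs ] ∑ (g x) f
∑-concatMap g []       f = refl
∑-concatMap g (x ∷ xs) f = trans (∑-++ (g x) (concatMap g xs) f) (cong (∑ (g x) f +_) (∑-concatMap g xs f))

∑-swap : ∀ (xs : List A) (ys : List B) (f : A → B → ℕ) →
         ∑[ x ∈ xs ] ∑ ys (f x) ≡ ∑[ y ∈ ys ] ∑[ x ∈ xs ] f x y
∑-swap []       ys f = sym (trans (∑-const ys 0) (*-zeroʳ (length ys)))
∑-swap (x ∷ xs) ys f = trans (cong (∑ ys (f x) +_) (∑-swap xs ys f)) (sym (∑-+ ys (f x) _))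

∑-member : ∀ {xs : List A} (f : A → ℕ) {x} → x ∈ xs → f x ≤ ∑ xs f
∑-member f (here refl) = m≤m+n _ _
∑-member f (there i)   = ≤-trans (∑-member f i) (m≤n+m _ _)

∑-members : ∀ {xs : List A} (f : A → ℕ) {x y} → x ∈ xs → y ∈ xs → x ≢ y → f x + f y ≤ ∑ xs f
∑-members f (here refl) (here refl) x≢y = contradiction refl x≢y
∑-members f (here refl) (there j)   x≢y = +-monoʳ-≤ _ (∑-member f j)
∑-members f {x} {y} (there i) (here refl) x≢y =
  ≤-trans (≤-reflexive (+-comm (f x) (f y))) (+-monoʳ-≤ (f y) (∑-member f i))
∑-members f (there i)   (there j)   x≢y = ≤-trans (∑-members f i j x≢y) (m≤n+m _ _)

length-concatMap : ∀ (g : A → List B) xs → length (concatMap g xs) ≡ ∑[ x ∈ xs ] length (g x)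
length-concatMap g []       = refl
length-concatMap g (x ∷ xs) = trans (length-++ (g x)) (cong (length (g x) +_) (length-concatMap g xs))

𝟙 : ∀ {P : Set} → Dec P → ℕ
𝟙 (yes _) = 1
𝟙 (no  _) = 0

𝟙-yes : ∀ {P : Set} (P? : Dec P) → P → 𝟙 P? ≡ 1
𝟙-yes (yes _) p = refl
𝟙-yes (no ¬p) p = contradiction p ¬p

𝟙-mono : ∀ {P Q : Set} (P? : Dec P) (Q? : Dec Q) → (P → Q) → 𝟙 P? ≤ 𝟙 Q?
𝟙-mono (no  _) Q? h = z≤n
𝟙-mono (yes p) Q? h = ≤-reflexive (sym (𝟙-yes Q? (h p)))

count : ∀ {P : A → Set} → Decidable P → List A → ℕ
count P? xs = ∑[ x ∈ xs ] 𝟙 (P? x)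

count-mono : ∀ {P Q : A → Set} (P? : Decidable P) (Q? : Decidable Q) → (∀ {x} → P x → Q x) →
             ∀ xs → count P? xs ≤ count Q? xs
count-mono P? Q? h xs = ∑-mono xs λ {x} _ → 𝟙-mono (P? x) (Q? x) h

count-none : ∀ {P : A → Set} (P? : Decidable P) → (∀ {x} → ¬ P x) → ∀ xs → count P? xs ≡ 0
count-none P? h []       = refl
count-none P? h (x ∷ xs) with P? x
... | yes p = contradiction p h
... | no  _ = count-none P? h xs

count-some : ∀ {P : A → Set} (P? : Decidable P) → ∀ xs → 0 < count P? xs → ∃ P
count-some P? (x ∷ xs) h with P? x
... | yes p = x , p
... | no  _ = count-some P? xs h

length-filter-count : ∀ {P : A → Set} (P? : Decidable P) → ∀ xs → length (filter P? xs) ≡ count P? xs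
length-filter-count P? []       = refl
length-filter-count P? (x ∷ xs) with P? x
... | yes _ = cong suc (length-filter-count P? xs)
... | no  _ = length-filter-count P? xs

count-unique : ∀ {P : A → Set} (P? : Decidable P) → (∀ {x y} → P x → P y → x ≡ y) →
               ∀ {xs} → Unique xs → count P? xs ≤ 1
count-unique P? h []                 = z≤n
count-unique P? h {x ∷ xs} (x∉xs ∷ u) with P? x
... | no  _ = count-unique P? h u
... | yes p = s≤s (≤-trans (∑-bound xs vanish) (≤-reflexive (*-zeroʳ (length xs))))
  where
  vanish : ∀ {y} → y ∈ xs → 𝟙 (P? y) ≤ 0
  vanish {y} y∈xs with P? y
  ... | yes q = contradiction (h p q) (All.lookup x∉xs y∈xs)
  ... | no  _ = z≤n

-- The list of all colourings, and recolouring a vertex.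

module _ {k : ℕ} where

  colourings : ∀ n → List (Vec (Fin k) n)
  colourings zero    = [] ∷ []
  colourings (suc n) = concatMap (λ α → map (α ∷_) (colourings n)) (allFin k)

  length-colourings : ∀ n → length (colourings n) ≡ k ^ n
  length-colourings zero    = refl
  length-colourings (suc n) = begin
    length (colourings (suc n))                                ≡⟨ length-concatMap _ (allFin k) ⟩
    ∑[ α ∈ allFin k ] length (map (α ∷_) (colourings n))  ≡⟨ ∑-cong (allFin k) (λ α → trans (length-map _ (colourings n)) (length-colourings n)) ⟩
    ∑[ _ ∈ allFin k ] (k ^ n)                                  ≡⟨ ∑-const (allFin k) (k ^ n) ⟩
    length (allFin k) * k ^ n                                  ≡⟨ cong (_* k ^ n) (length-tabulate {n = k} (λ i → i)) ⟩
    k * k ^ n                                                  ∎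
    where open ≡-Reasoning

  ∑-colourings : ∀ n (f : Vec (Fin k) (suc n) → ℕ) →
                 ∑ (colourings (suc n)) f ≡ ∑[ α ∈ allFin k ] ∑[ c ∈ colourings n ] f (α ∷ c)
  ∑-colourings n f = trans (∑-concatMap _ (allFin k) f)
    (∑-cong (allFin k) λ α → ∑-map (α ∷_) (colourings n) f)

  -- A colouring d is hit k times: α must be the colour of v in d, while c may give v any colour.
  ∑-recolour : ∀ {n} (v : Fin n) (f : Vec (Fin k) n → ℕ) →
               ∑[ c ∈ colourings n ] ∑[ α ∈ allFin k ] f (c [ v ]≔ α) ≡ k * ∑ (colourings n) f
  ∑-recolour {suc n} zero f = begin
    ∑[ c ∈ colourings (suc n) ] ∑[ α ∈ allFin k ] f (c [ zero ]≔ α)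
      ≡⟨ ∑-colourings n _ ⟩
    ∑[ _ ∈ allFin k ] ∑[ c ∈ colourings n ] ∑[ α ∈ allFin k ] f (α ∷ c)
      ≡⟨ ∑-const (allFin k) _ ⟩
    length (allFin k) * ∑[ c ∈ colourings n ] ∑[ α ∈ allFin k ] f (α ∷ c)
      ≡⟨ cong₂ _*_ (length-tabulate {n = k} (λ i → i)) (trans (∑-swap (colourings n) (allFin k) _) (sym (∑-colourings n f))) ⟩
    k * ∑ (colourings (suc n)) f ∎
    where open ≡-Reasoning
  ∑-recolour {suc n} (suc v) f = begin
    ∑[ c ∈ colourings (suc n) ] ∑[ α ∈ allFin k ] f (c [ suc v ]≔ α)
      ≡⟨ ∑-colourings n _ ⟩
    ∑[ β ∈ allFin k ] ∑[ c ∈ colourings n ] ∑[ α ∈ allFin k ] f (β ∷ (c [ v ]≔ α))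
      ≡⟨ ∑-cong (allFin k) (λ β → ∑-recolour v (f ∘ (β ∷_))) ⟩
    ∑[ β ∈ allFin k ] (k * ∑[ c ∈ colourings n ] f (β ∷ c))
      ≡⟨ ∑-* (allFin k) k _ ⟩
    k * ∑[ β ∈ allFin k ] ∑[ c ∈ colourings n ] f (β ∷ c)
      ≡⟨ cong (k *_) (∑-colourings n f) ⟨
    k * ∑ (colourings (suc n)) f ∎
    where open ≡-Reasoning

  -- Among the k recolourings of c at v at most one satisfies P, and none does unless c satisfies Q.
  -- By `∑-recolour` these families cover each colouring k times.
  count-forced : ∀ {n} {P Q : Vec (Fin k) n → Set} (P? : Decidable P) (Q? : Decidable Q)
                 (v : Fin n) (g : Vec (Fin k) n → Fin k) →
                 (∀ c α → P (c [ v ]≔ α) → Q c × α ≡ g c) →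
                 k * count P? (colourings n) ≤ count Q? (colourings n)
  count-forced {n} P? Q? v g h = begin
    k * count P? (colourings n)
      ≡⟨ ∑-recolour v (𝟙 ∘ P?) ⟨
    ∑[ c ∈ colourings n ] ∑[ α ∈ allFin k ] 𝟙 (P? (c [ v ]≔ α))
      ≤⟨ ∑-mono (colourings n) (λ {c} _ → fibre c) ⟩
    count Q? (colourings n) ∎
    where
    open ≤-Reasoning
    fibre : ∀ c → ∑[ α ∈ allFin k ] 𝟙 (P? (c [ v ]≔ α)) ≤ 𝟙 (Q? c)
    fibre c with Q? c
    ... | no ¬q = ≤-reflexive (count-none (λ α → P? (c [ v ]≔ α)) (λ p → ¬q (proj₁ (h c _ p))) (allFin k))
    ... | yes _ = count-unique (λ α → P? (c [ v ]≔ α))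
      (λ p q → trans (proj₂ (h c _ p)) (sym (proj₂ (h c _ q)))) (Uniqueₚ.allFin⁺ k)

∑-filter : ∀ {P : A → Set} (P? : Decidable P) xs (f : A → ℕ) →
           ∑ (filter P? xs) f ≡ ∑[ x ∈ xs ] (𝟙 (P? x) * f x)
∑-filter P? []       f = refl
∑-filter P? (x ∷ xs) f with P? x
... | yes _ = cong₂ _+_ (sym (*-identityˡ (f x))) (∑-filter P? xs f)
... | no  _ = ∑-filter P? xs f

length-filter-¬ : ∀ {P : A → Set} (P? : Decidable P) xs →
                  length (filter (¬? ∘ P?) xs) + length (filter P? xs) ≡ length xs
length-filter-¬ P? []       = refl
length-filter-¬ P? (x ∷ xs) with P? x
... | yes _ = trans (+-suc _ _) (cong suc (length-filter-¬ P? xs))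
... | no  _ = cong suc (length-filter-¬ P? xs)

-- Walks, codegrees and special vertices.

module Walks {n : ℕ} (G : Graph n) where
  open Graph G

  private
    V = Fin n

  neighbours : V → List V
  neighbours v = filter (v ~?_) (allFin n)

  ∈-neighbours : ∀ {v w} → v ~ w → w ∈ neighbours v
  ∈-neighbours {v} a = ∈-filter⁺ (v ~?_) (∈-allFin _) a

  commonNeighbours : V → V → List V
  commonNeighbours v w = filter (_~? w) (neighbours v)

  codegree : V → V → ℕ
  codegree v w = length (commonNeighbours v w)

  -- The list holds the interior vertices of a walk between the two ends.
  Walk : V → List V → V → Set
  Walk u []       w = u ~ w
  Walk u (x ∷ xs) w = u ~ x × Walk x xs w

  walk? : ∀ u xs w → Dec (Walk u xs w)
  walk? u []       w = u ~? w
  walk? u (x ∷ xs) w with u ~? x | walk? x xs w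
  ... | yes a | yes p = yes (a , p)
  ... | no ¬a | _     = no (¬a ∘ proj₁)
  ... | _     | no ¬p = no (¬p ∘ proj₂)

  walk-++ : ∀ {u y w} xs {ys} → Walk u xs y → Walk y ys w → Walk u (xs ++ y ∷ ys) w
  walk-++ []       a       q = a , q
  walk-++ (x ∷ xs) (a , p) q = a , walk-++ xs p q

  walk-split : ∀ {u y w} xs {ys} → Walk u (xs ++ y ∷ ys) w → Walk u xs y × Walk y ys w
  walk-split []       (a , q) = a , q
  walk-split (x ∷ xs) (a , p) with walk-split xs p
  ... | q , r = (a , q) , r

  walk-reverse : ∀ {u w} xs → Walk u xs w → Walk w (reverse xs) u
  walk-reverse []               a       = symmetric a
  walk-reverse {u} {w} (x ∷ xs) (a , p) = subst (λ ys → Walk w ys u) (sym (unfold-reverse x xs))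
    (walk-++ (reverse xs) (walk-reverse xs p) (symmetric a))

  walk-tabulate : ∀ m (f : Fin (suc m) → Fin n) {u} → (∀ i → f (inject₁ i) ~ f (suc i)) → f (fromℕ m) ~ u →
                  Walk (f zero) (tabulate (f ∘ suc)) u
  walk-tabulate zero    f adj last = last
  walk-tabulate (suc m) f adj last = adj zero , walk-tabulate m (f ∘ suc) (adj ∘ suc) last

  -- Walks to v are stored from their free end back to v, with v itself left out. The empty list is
  -- the trivial walk, whose free end is v.
  tip : V → List V → V
  tip v []      = v
  tip v (x ∷ _) = x

  extend : V → List V → List (List V)
  extend v p = map (_∷ p) (neighbours (tip v p))

  walksTo : V → ℕ → List (List V)
  walksTo v zero    = [] ∷ []
  walksTo v (suc ℓ) = concatMap (extend v) (walksTo v ℓ)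

  ∈-extend : ∀ {ps : List (List V)} (f : List V → List V) {x p} → p ∈ ps → x ∈ f p →
             x ∷ p ∈ concatMap (λ p → map (_∷ p) (f p)) ps
  ∈-extend f {x} {p} p∈ x∈ = ∈-concatMap⁺ _ (Any.map (λ { refl → ∈-map⁺ (_∷ p) x∈ }) p∈)

  ∈-walksTo : ∀ {x v} p → Walk x p v → x ∷ p ∈ walksTo v (suc (length p))
  ∈-walksTo {v = v} []      a       = ∈-extend {ps = [] ∷ []} (neighbours ∘ tip v) (here refl) (∈-neighbours (symmetric a))
  ∈-walksTo {v = v} (y ∷ p) (a , w) = ∈-extend (neighbours ∘ tip v) (∈-walksTo p w) (∈-neighbours (symmetric a))

  length-extend : ∀ (ps : List (List V)) (f : List V → List V) {m} →
                  (∀ {p} → p ∈ ps → length (f p) ≤ m) →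
                  length (concatMap (λ p → map (_∷ p) (f p)) ps) ≤ length ps * m
  length-extend ps f h = ≤-trans (≤-reflexive (length-concatMap _ ps))
    (∑-bound ps λ {p} p∈ → ≤-trans (≤-reflexive (length-map (_∷ p) (f p))) (h p∈))

  module _ (D : ℕ) where

    special : V → List V
    special v = filter (λ w → D <? codegree v w) (allFin n)

    tipSpecial? : ∀ v (p : List V) → Dec (D < codegree v (tip v p))
    tipSpecial? v p = D <? codegree v (tip v p)

    ordinaryWalks : V → ℕ → List (List V)
    ordinaryWalks v ℓ = filter (¬? ∘ tipSpecial? v) (walksTo v ℓ)

    -- Closed walks v, x₁, x₂, …, v with interior of length ℓ + 1 in which x₂
    -- is not special for v.
    closedWalks : V → ℕ → List (List V)
    closedWalks v ℓ = concatMap (λ p → map (_∷ p) (commonNeighbours v (tip v p))) (ordinaryWalks v ℓ)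

    ∈-closedWalks : ∀ {v x y p} → Walk v (x ∷ y ∷ p) v → ¬ D < codegree v y →
                    x ∷ y ∷ p ∈ closedWalks v (suc (length p))
    ∈-closedWalks {v} {x} {y} {p} (v~x , x~y , w) ¬sp = ∈-extend (commonNeighbours v ∘ tip v)
      (∈-filter⁺ (¬? ∘ tipSpecial? v) (∈-walksTo p w) ¬sp)
      (∈-filter⁺ (_~? y) (∈-neighbours v~x) x~y)

    -- The entry x₁ is a common neighbour of v and x₂, and x₂ is not special, which leaves at most D
    -- choices.
    length-closedWalks : ∀ v ℓ → length (closedWalks v ℓ) ≤ length (ordinaryWalks v ℓ) * D
    length-closedWalks v ℓ = length-extend (ordinaryWalks v ℓ) (commonNeighbours v ∘ tip v)
      λ p∈ → ≮⇒≥ (proj₂ (∈-filter⁻ (¬? ∘ tipSpecial? v) {xs = walksTo v ℓ} p∈))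

    -- The middle vertex of a walk of length two between v and w is a common neighbour of the two,
    -- so w is the tip of `codegree v w` such walks.
    ∑-walksTo₂ : ∀ v (f : V → ℕ) →
                 ∑[ p ∈ walksTo v 2 ] f (tip v p) ≡ ∑[ w ∈ allFin n ] (f w * codegree v w)
    ∑-walksTo₂ v f = begin
      ∑[ p ∈ walksTo v 2 ] f (tip v p)
        ≡⟨ ∑-concatMap _ (walksTo v 1) (f ∘ tip v) ⟩
      ∑[ p ∈ walksTo v 1 ] ∑ (map (_∷ p) (neighbours (tip v p))) (f ∘ tip v)
        ≡⟨ ∑-cong (walksTo v 1) (λ p → ∑-map (_∷ p) (neighbours (tip v p)) (f ∘ tip v)) ⟩
      ∑[ p ∈ walksTo v 1 ] ∑ (neighbours (tip v p)) f
        ≡⟨ trans (∑-concatMap (extend v) ([] ∷ []) (λ p → ∑ (neighbours (tip v p)) f)) (+-identityʳ _) ⟩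
      ∑[ p ∈ map (_∷ []) (neighbours v) ] ∑ (neighbours (tip v p)) f
        ≡⟨ ∑-map (_∷ []) (neighbours v) _ ⟩
      ∑[ y ∈ neighbours v ] ∑ (neighbours y) f
        ≡⟨ ∑-cong (neighbours v) (λ y → ∑-filter (y ~?_) (allFin n) f) ⟩
      ∑[ y ∈ neighbours v ] ∑[ w ∈ allFin n ] (𝟙 (y ~? w) * f w)
        ≡⟨ ∑-swap (neighbours v) (allFin n) _ ⟩
      ∑[ w ∈ allFin n ] ∑[ y ∈ neighbours v ] (𝟙 (y ~? w) * f w)
        ≡⟨ ∑-cong (allFin n) (λ w → trans (∑-cong (neighbours v) (λ y → *-comm (𝟙 (y ~? w)) (f w)))
             (trans (∑-* (neighbours v) (f w) _) (cong (f w *_) (sym (length-filter-count (_~? w) (neighbours v)))))) ⟩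
      ∑[ w ∈ allFin n ] (f w * codegree v w) ∎
      where open ≡-Reasoning

    -- A special vertex is the tip of at least D + 1 walks of length two, and the ordinary walks are
    -- the remaining ones. Keeping both terms lets special vertices and 4-cycles share a single
    -- budget of Δ² walks.
    length-special : ∀ v → length (special v) * suc D + length (ordinaryWalks v 2) ≤ length (walksTo v 2)
    length-special v = begin
      length (special v) * suc D + length (ordinaryWalks v 2)
        ≤⟨ +-monoˡ-≤ _ bound ⟩
      length (filter (tipSpecial? v) (walksTo v 2)) + length (ordinaryWalks v 2)
        ≡⟨ trans (+-comm (length (filter (tipSpecial? v) (walksTo v 2))) _) (length-filter-¬ (tipSpecial? v) (walksTo v 2)) ⟩
      length (walksTo v 2) ∎
      where
      open ≤-Reasoning
      sp? : ∀ w → Dec (D < codegree v w)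
      sp? w = D <? codegree v w
      weigh : ∀ w → suc D * 𝟙 (sp? w) ≤ 𝟙 (sp? w) * codegree v w
      weigh w with sp? w
      ... | yes h = ≤-trans (≤-reflexive (*-identityʳ (suc D))) (≤-trans h (≤-reflexive (sym (*-identityˡ _))))
      ... | no  _ = ≤-reflexive (*-zeroʳ (suc D))
      bound : length (special v) * suc D ≤ length (filter (tipSpecial? v) (walksTo v 2))
      bound = begin
        length (special v) * suc D
          ≡⟨ trans (*-comm _ (suc D)) (cong (suc D *_) (length-filter-count sp? (allFin n))) ⟩
        suc D * count sp? (allFin n)
          ≡⟨ ∑-* (allFin n) (suc D) _ ⟨
        ∑[ w ∈ allFin n ] (suc D * 𝟙 (sp? w))
          ≤⟨ ∑-mono (allFin n) (λ {w} _ → weigh w) ⟩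
        ∑[ w ∈ allFin n ] (𝟙 (sp? w) * codegree v w)
          ≡⟨ ∑-walksTo₂ v (𝟙 ∘ sp?) ⟨
        count (tipSpecial? v) (walksTo v 2)
          ≡⟨ length-filter-count (tipSpecial? v) (walksTo v 2) ⟨
        length (filter (tipSpecial? v) (walksTo v 2)) ∎

  module _ {Δ : ℕ} (deg≤Δ : ∀ v → degree G v ≤ Δ) where

    length-walksTo : ∀ v ℓ → length (walksTo v ℓ) ≤ Δ ^ ℓ
    length-walksTo v zero    = ≤-refl
    length-walksTo v (suc ℓ) = begin
      length (walksTo v (suc ℓ)) ≤⟨ length-extend (walksTo v ℓ) (neighbours ∘ tip v) (λ {p} _ → deg≤Δ (tip v p)) ⟩
      length (walksTo v ℓ) * Δ   ≤⟨ *-monoˡ-≤ Δ (length-walksTo v ℓ) ⟩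
      Δ ^ ℓ * Δ                  ≡⟨ *-comm (Δ ^ ℓ) Δ ⟩
      Δ ^ suc ℓ                  ∎
      where open ≤-Reasoning

-- Auxiliary facts on degrees, bounded search and subsets.

degree≤maxDegree : ∀ {n} (G : Graph n) v → degree G v ≤ maxDegree G
degree≤maxDegree G v = All.lookup (xs≤max 0 (map (degree G) (allFin _))) (∈-map⁺ (degree G) (∈-allFin v))

anyList? : ∀ {n} {P : List (Fin n) → Set} → Decidable P → ∀ N → Dec (∃ λ xs → length xs ≤ N × P xs)
anyList? P? N with P? []
... | yes p = yes ([] , z≤n , p)
anyList? P? zero    | no ¬p = no λ { ([] , _ , p) → ¬p p }
anyList? P? (suc N) | no ¬p = map′
  (λ { (x , xs , h , p) → x ∷ xs , s≤s h , p })
  (λ { ([] , _ , p) → contradiction p ¬p ; (x ∷ xs , s≤s h , p) → x , xs , h , p })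
  (Finₚ.any? λ x → anyList? (P? ∘ (x ∷_)) N)

unique⇒length≤ : ∀ {n} {xs : List (Fin n)} → Unique xs → length xs ≤ n
unique⇒length≤ {n} {xs} u = begin
  length xs                                      ≡⟨ trans (∑-const xs 1) (*-identityʳ _) ⟨
  ∑[ x ∈ xs ] 1                                  ≤⟨ ∑-mono xs (λ {x} _ → some x) ⟩
  ∑[ x ∈ xs ] ∑[ w ∈ allFin n ] 𝟙 (x Finₚ.≟ w)   ≡⟨ ∑-swap xs (allFin n) _ ⟩
  ∑[ w ∈ allFin n ] count (Finₚ._≟ w) xs         ≤⟨ ∑-bound (allFin n) (λ {w} _ → count-unique (Finₚ._≟ w) (λ p q → trans p (sym q)) u) ⟩
  length (allFin n) * 1                          ≡⟨ trans (*-identityʳ _) (length-tabulate {n = n} id) ⟩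
  n                                              ∎
  where
  open ≤-Reasoning
  some : ∀ x → 1 ≤ ∑[ w ∈ allFin n ] 𝟙 (x Finₚ.≟ w)
  some x = ≤-trans (≤-reflexive (sym (𝟙-yes (x Finₚ.≟ x) refl))) (∑-member (λ w → 𝟙 (x Finₚ.≟ w)) (∈-allFin x))

x∉p-x : ∀ {n} (p : Subset n) x → x ∉ₛ p - x
x∉p-x (s ∷ p)       zero    ()
x∉p-x (inside ∷ p)  (suc x) (there h) = x∉p-x p x h
x∉p-x (outside ∷ p) (suc x) (there h) = x∉p-x p x h

restore : ∀ {n} {p : Subset n} x → p ⊆ₛ (p - x) ∪ ⁅ x ⁆
restore {p = p} x {y} y∈ with y Finₚ.≟ x
... | yes refl = x∈p∪q⁺ {p = p - x} (inj₂ (x∈⁅x⁆ x))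
... | no y≢x   = x∈p∪q⁺ {p = p - x} (inj₁ (x∈p∧x≢y⇒x∈p-y y∈ y≢x))

-- Colourings that are valid on a set of vertices.

module Partial {n k : ℕ} (G : Graph n) where
  open Graph G
  open Walks G

  private
    V = Fin n
    Colouring = Vec (Fin k) n

  TwoColoured : Colouring → List V → Set
  TwoColoured c xs = ∃ λ a → ∃ λ b → All (λ x → lookup c x ≡ a ⊎ lookup c x ≡ b) xs

  Clash : Subset n → Colouring → Set
  Clash X c = ∃ λ u → ∃ λ w → u ∈ₛ X × w ∈ₛ X × u ~ w × lookup c u ≡ lookup c w

  -- The bound on the length rules out an edge walked there and back.
  TwoColouredCycle : Subset n → Colouring → V → List V → Set
  TwoColouredCycle X c v xs =
    Unique (v ∷ xs) × All (_∈ₛ X) (v ∷ xs) × Walk v xs v × 2 ≤ length xs × TwoColoured c (v ∷ xs)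

  Bad : Subset n → Colouring → Set
  Bad X c = Clash X c ⊎ ∃ λ v → ∃ λ xs → TwoColouredCycle X c v xs

  Valid : Subset n → Colouring → Set
  Valid X c = ¬ Bad X c

  clash? : ∀ X c → Dec (Clash X c)
  clash? X c = Finₚ.any? λ u → Finₚ.any? λ w →
    (u ∈? X) ×-dec (w ∈? X) ×-dec (u ~? w) ×-dec (lookup c u Finₚ.≟ lookup c w)

  twoColouredCycle? : ∀ X c v xs → Dec (TwoColouredCycle X c v xs)
  twoColouredCycle? X c v xs = unique? Finₚ._≟_ (v ∷ xs) ×-dec all? (_∈? X) (v ∷ xs) ×-dec
    walk? v xs v ×-dec (2 ≤? length xs) ×-dec
    Finₚ.any? λ a → Finₚ.any? λ b → all? (λ x → (lookup c x Finₚ.≟ a) ⊎-dec (lookup c x Finₚ.≟ b)) (v ∷ xs)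

  bad? : ∀ X c → Dec (Bad X c)
  bad? X c = clash? X c ⊎-dec Finₚ.any? λ v → map′
    (λ (xs , _ , p) → xs , p)
    (λ { (xs , p@(_ ∷ u , _)) → xs , unique⇒length≤ u , p })
    (anyList? (twoColouredCycle? X c v) n)

  valid? : ∀ X c → Dec (Valid X c)
  valid? X c = ¬? (bad? X c)

  -- The colours outside X are arbitrary, so this is k^(n − ∣X∣) times the
  -- number of valid colourings of X alone, whence the factor k in Extensible.
  #valid : Subset n → ℕ
  #valid X = count (valid? X) (colourings n)

  -- Badness depends only on the colours inside X and persists in larger sets. This serves both to
  -- shrink X and to recolour a vertex outside X.
  bad-resp : ∀ {X Y} c d → X ⊆ₛ Y → (∀ {x} → x ∈ₛ X → lookup c x ≡ lookup d x) → Bad X c → Bad Y d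
  bad-resp c d X⊆Y e (inj₁ (u , w , u∈ , w∈ , a , q)) =
    inj₁ (u , w , X⊆Y u∈ , X⊆Y w∈ , a , trans (sym (e u∈)) (trans q (e w∈)))
  bad-resp c d X⊆Y e (inj₂ (v , xs , u , X∋ , p , l , a , b , q)) =
    inj₂ (v , xs , u , All.map X⊆Y X∋ , p , l , a , b ,
      All.map (λ (x∈ , h) → map⊎ (trans (sym (e x∈))) (trans (sym (e x∈))) h) (All.zip (X∋ , q)))

  valid-antitone : ∀ {X Y} c → X ⊆ₛ Y → Valid Y c → Valid X c
  valid-antitone c X⊆Y h = h ∘ bad-resp c c X⊆Y (λ _ → refl)

  #valid-antitone : ∀ {X Y} → X ⊆ₛ Y → #valid Y ≤ #valid X
  #valid-antitone {X} {Y} X⊆Y = count-mono (valid? Y) (valid? X) (λ {c} → valid-antitone c X⊆Y) (colourings n)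

  valid⇒acyclic : ∀ {c} → Valid ⊤ c → IsAcyclicColouring G (lookup c)
  valid⇒acyclic h = record
    { proper  = λ u v a e → h (inj₁ (u , v , ∈⊤ , ∈⊤ , a , e))
    ; acyclic = λ {l} v C (a , b , e) → h (inj₂ (v zero , tabulate (v ∘ suc) ,
        Uniqueₚ.tabulate⁺ (IsCycle.distinct C) , All.universal (λ _ → ∈⊤) _ ,
        walk-tabulate (2 + l) v (IsCycle.adjacent C) (IsCycle.closing C) ,
        ≤-trans (m≤m+n 2 l) (≤-reflexive (sym (length-tabulate (v ∘ suc)))) ,
        a , b , Allₚ.tabulate⁺ e))
    }

  valid-recolour : ∀ {X v} c α → v ∉ₛ X → Valid X (c [ v ]≔ α) → Valid X c
  valid-recolour {X} {v} c α v∉X h = h ∘ bad-resp c (c [ v ]≔ α) id λ {x} x∈ →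
    sym (lookup∘updateAt′ x v (λ { refl → v∉X x∈ }) c)

  Alternating : Colouring → Fin k → Fin k → List V → Set
  Alternating c a b []       = Unit
  Alternating c a b (x ∷ xs) = lookup c x ≡ a × Alternating c b a xs

  alternating? : ∀ c a b xs → Dec (Alternating c a b xs)
  alternating? c a b []       = yes tt
  alternating? c a b (x ∷ xs) = (lookup c x Finₚ.≟ a) ×-dec alternating? c b a xs

  alternating-recolour : ∀ {c v α a b xs} → All (v ≢_) xs → Alternating (c [ v ]≔ α) a b xs → Alternating c a b xs
  alternating-recolour []       _       = tt
  alternating-recolour {c} {v} (v≢x ∷ h) (e , q) =
    trans (sym (lookup∘updateAt′ _ v (v≢x ∘ sym) c)) e , alternating-recolour {c} h q

  Extensible : ℕ → Subset n → Set
  Extensible β X = ∀ v → v ∉ₛ X → β * #valid X ≤ k * #valid (X ∪ ⁅ v ⁆)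

  -- The vertices of xs are uncoloured one at a time: each is forced, which
  -- gains a factor k, and colouring it freely again costs a factor k / β.
  count-alternating : ∀ {β} .{{_ : NonZero k}} {x y} xs X →
    (∀ Y → ∣ Y ∣ < ∣ X ∣ → Extensible β Y) →
    Unique xs → All (x ≢_) xs → All (y ≢_) xs → All (_∈ₛ X) xs →
    β ^ length xs * count (λ c → valid? X c ×-dec alternating? c (lookup c x) (lookup c y) xs) (colourings n) ≤ #valid X
  count-alternating {x = x} {y} [] X ext u x∉ y∉ X∋ = ≤-trans (≤-reflexive (*-identityˡ _))
    (count-mono (λ c → valid? X c ×-dec alternating? c (lookup c x) (lookup c y) []) (valid? X) proj₁ (colourings n))
  count-alternating {β} {x} {y} (p ∷ xs) X ext (p∉ ∷ u) (x≢p ∷ x∉) (y≢p ∷ y∉) (p∈X ∷ X∋) = *-cancelˡ-≤ k (begin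
    k * (β * β ^ length xs * N)             ≡⟨ shuffle k β (β ^ length xs) N ⟩
    β * (β ^ length xs * (k * N))           ≤⟨ *-monoʳ-≤ β (*-monoʳ-≤ (β ^ length xs) forced) ⟩
    -- `p` takes the colour of x and its successor that of y, so x and y exchange roles in the
    -- recursive call.
    β * (β ^ length xs * N′)                ≤⟨ *-monoʳ-≤ β (count-alternating {β} {y = x} xs X′
                                                 (λ Y h → ext Y (<-trans h smaller)) u y∉ x∉ X′∋) ⟩
    β * #valid X′                           ≤⟨ ext X′ smaller p (x∉p-x X p) ⟩
    k * #valid (X′ ∪ ⁅ p ⁆)                 ≤⟨ *-monoʳ-≤ k (#valid-antitone (restore p)) ⟩
    k * #valid X                            ∎)
    where
    open ≤-Reasoning
    X′ = X - p
    smaller : ∣ X′ ∣ < ∣ X ∣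
    smaller = x∈p⇒∣p-x∣<∣p∣ p∈X
    P? : ∀ c → Dec (Valid X c × Alternating c (lookup c x) (lookup c y) (p ∷ xs))
    P? c = valid? X c ×-dec alternating? c (lookup c x) (lookup c y) (p ∷ xs)
    Q? : ∀ c → Dec (Valid X′ c × Alternating c (lookup c y) (lookup c x) xs)
    Q? c = valid? X′ c ×-dec alternating? c (lookup c y) (lookup c x) xs
    N  = count P? (colourings n)
    N′ = count Q? (colourings n)
    X′∋ : All (_∈ₛ X′) xs
    X′∋ = All.map (λ (q , h) → x∈p∧x≢y⇒x∈p-y q (h ∘ sym)) (All.zip (X∋ , p∉))
    forced : k * N ≤ N′
    forced = count-forced P? Q? p (λ c → lookup c x) λ c α (h , e , q) →
      let ex = lookup∘updateAt′ x p x≢p c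
          ey = lookup∘updateAt′ y p y≢p c
      in ( valid-recolour c α (x∉p-x X p) (valid-antitone (c [ p ]≔ α) (p─q⊆p X ⁅ p ⁆) h)
         , subst₂ (λ a b → Alternating c a b xs) ey ex (alternating-recolour {c} p∉ q))
         , trans (sym (lookup∘updateAt p c)) (trans e ex)
    shuffle : ∀ k β q N → k * (β * q * N) ≡ β * (q * (k * N))
    shuffle = solve-∀

-- The ways in which colouring one more vertex can fail.

unique-resp-↭ : ∀ {A : Set} {xs ys : List A} → xs ↭ ys → Unique xs → Unique ys
unique-resp-↭ {A} p = Permutationₛ.Unique-resp-↭ (setoid A) (↭⇒↭ₛ p)

-- The head of the reversed list is an entry of the tail, hence differs from the original head. The
-- two directions of a cycle are thus two different closed walks.
unique⇒≢reverse : ∀ {A : Set} {xs : List A} → Unique xs → 2 ≤ length xs → xs ≢ reverse xs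
unique⇒≢reverse {xs = x ∷ []} _ (s≤s ())
unique⇒≢reverse {xs = x ∷ y ∷ ys} (x∉ ∷ _) _ e
  with reverse (y ∷ ys) | ↭-reverse (y ∷ ys) | trans e (unfold-reverse x (y ∷ ys))
... | []    | p | _ with () ← ↭-length p
... | z ∷ _ | p | q = All.lookup x∉ (∈-resp-↭ p (here refl)) (∷-injectiveˡ q)

module Events {n k : ℕ} (G : Graph n) where
  open Graph G
  open Walks G
  open Partial {n} {k} G

  private
    V = Fin n
    Colouring = Vec (Fin k) n

  SameColour : V → V → Colouring → Set
  SameColour v w c = w ≢ v × lookup c v ≡ lookup c w

  sameColour? : ∀ v w c → Dec (SameColour v w c)
  sameColour? v w c = ¬? (w Finₚ.≟ v) ×-dec (lookup c v Finₚ.≟ lookup c w)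

  -- v ∷ xs repeats with period two in c, where xs consists of m + 2 vertices.
  Periodic : Subset n → V → ℕ → List V → Colouring → Set
  Periodic X v m (x ∷ y ∷ xs) c =
    (length xs ≡ m × Unique (v ∷ x ∷ y ∷ xs) × All (_∈ₛ X) xs) ×
    (lookup c v ≡ lookup c y × Alternating c (lookup c x) (lookup c y) xs)
  Periodic X v m _            c = Empty

  periodic? : ∀ X v m xs c → Dec (Periodic X v m xs c)
  periodic? X v m []           c = no λ ()
  periodic? X v m (_ ∷ [])     c = no λ ()
  periodic? X v m (x ∷ y ∷ xs) c =
    ((length xs ≟ m) ×-dec unique? Finₚ._≟_ (v ∷ x ∷ y ∷ xs) ×-dec all? (_∈? X) xs) ×-dec
    ((lookup c v Finₚ.≟ lookup c y) ×-dec alternating? c (lookup c x) (lookup c y) xs)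

  #same : Subset n → V → V → ℕ
  #same X v w = count (λ c → valid? X c ×-dec sameColour? v w c) (colourings n)

  #periodic : Subset n → V → ℕ → List V → ℕ
  #periodic X v m xs = count (λ c → valid? X c ×-dec periodic? X v m xs c) (colourings n)

  -- The colour of v must copy that of w, which is one colour in k; as v lies outside X, recolouring
  -- it does not affect validity on X.
  count-same : ∀ {X v} → v ∉ₛ X → ∀ w → k * #same X v w ≤ #valid X
  count-same {X} {v} v∉X w = count-forced (λ c → valid? X c ×-dec sameColour? v w c) (valid? X) v (λ c → lookup c w)
    λ c α (h , w≢v , e) → valid-recolour c α v∉X h ,
      trans (sym (lookup∘updateAt v c)) (trans e (lookup∘updateAt′ w v w≢v c))

  -- Of the m + 3 vertices, x and y serve as the reference for the two colours. Forcing v yields the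
  -- factor k, and the m vertices after y yield β^m by `count-alternating`.
  count-periodic : ∀ {β X v} .{{_ : NonZero k}} → v ∉ₛ X → (∀ Y → ∣ Y ∣ < ∣ X ∣ → Extensible β Y) →
                   ∀ m xs → β ^ m * (k * #periodic X v m xs) ≤ #valid X
  count-periodic {β} {X} {v} v∉X ext m xs = go xs
    where
    open ≤-Reasoning
    none : ∀ xs → (∀ {c} → ¬ (Valid X c × Periodic X v m xs c)) → β ^ m * (k * #periodic X v m xs) ≤ #valid X
    none xs h rewrite count-none (λ c → valid? X c ×-dec periodic? X v m xs c) h (colourings n)
      | *-zeroʳ k | *-zeroʳ (β ^ m) = z≤n
    go : ∀ xs → β ^ m * (k * #periodic X v m xs) ≤ #valid X
    go []       = none [] proj₂
    go (x ∷ []) = none (x ∷ []) proj₂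
    -- The first half of `Periodic` does not mention the colouring, so it is settled once, before
    -- counting; if it fails, the count is zero.
    go (x ∷ y ∷ xs) = decide ((length xs ≟ m) ×-dec unique? Finₚ._≟_ (v ∷ x ∷ y ∷ xs) ×-dec all? (_∈? X) xs)
      where
      decide : Dec (length xs ≡ m × Unique (v ∷ x ∷ y ∷ xs) × All (_∈ₛ X) xs) →
               β ^ m * (k * #periodic X v m (x ∷ y ∷ xs)) ≤ #valid X
      decide (no ¬h) = none (x ∷ y ∷ xs) (¬h ∘ proj₁ ∘ proj₂)
      decide (yes (refl , (v≢x ∷ v≢y ∷ v∉) ∷ (_ ∷ x∉) ∷ y∉ ∷ u , X∋)) = begin
        β ^ length xs * (k * #periodic X v (length xs) (x ∷ y ∷ xs))
          ≤⟨ *-monoʳ-≤ (β ^ length xs) (count-forced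
               (λ c → valid? X c ×-dec periodic? X v (length xs) (x ∷ y ∷ xs) c)
               (λ c → valid? X c ×-dec alternating? c (lookup c x) (lookup c y) xs)
               v (λ c → lookup c y) forced) ⟩
        β ^ length xs * count (λ c → valid? X c ×-dec alternating? c (lookup c x) (lookup c y) xs) (colourings n)
          ≤⟨ count-alternating {β} xs X ext u x∉ y∉ X∋ ⟩
        #valid X ∎
        where
        forced : ∀ c α → Valid X (c [ v ]≔ α) × Periodic X v (length xs) (x ∷ y ∷ xs) (c [ v ]≔ α) →
                 (Valid X c × Alternating c (lookup c x) (lookup c y) xs) × α ≡ lookup c y
        forced c α (h , _ , e , q) =
          let ex = lookup∘updateAt′ x v (v≢x ∘ sym) c
              ey = lookup∘updateAt′ y v (v≢y ∘ sym) c
          in (valid-recolour c α v∉X h , subst₂ (λ a b → Alternating c a b xs) ex ey (alternating-recolour {c} v∉ q))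
           , trans (sym (lookup∘updateAt v c)) (trans e ey)

  module _ {X : Subset n} {c : Colouring} (noClash : ¬ Clash X c) {v : V} (v∈X : v ∈ₛ X) where

    -- A properly 2-coloured walk back to v alternates, so its parity is known.
    alternate-odd : ∀ {a b} x xs → lookup c v ≡ a → lookup c x ≡ a → All (_∈ₛ X) (x ∷ xs) →
                    All (λ y → lookup c y ≡ a ⊎ lookup c y ≡ b) xs → Walk x xs v →
                    (∃ λ j → length xs ≡ suc (j + j)) × Alternating c b a xs
    alternate-even : ∀ {a b} x xs → lookup c v ≡ a → lookup c x ≡ b → All (_∈ₛ X) (x ∷ xs) →
                     All (λ y → lookup c y ≡ a ⊎ lookup c y ≡ b) xs → Walk x xs v →
                     (∃ λ j → length xs ≡ j + j) × Alternating c a b xs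
    alternate-odd x []       ev ex (x∈ ∷ _) _ x~v = ⊥-elim (noClash (x , v , x∈ , v∈X , x~v , trans ex (sym ev)))
    alternate-odd x (y ∷ xs) ev ex (x∈ ∷ y∈ ∷ _) (inj₁ ey ∷ _) (x~y , _) =
      ⊥-elim (noClash (x , y , x∈ , y∈ , x~y , trans ex (sym ey)))
    alternate-odd x (y ∷ xs) ev ex (_ ∷ X∋) (inj₂ ey ∷ h) (_ , w) with alternate-even y xs ev ey X∋ h w
    ... | (j , e) , q = (j , cong suc e) , ey , q
    alternate-even x []       ev ex _ _ _ = (0 , refl) , _
    alternate-even x (y ∷ xs) ev ex (x∈ ∷ y∈ ∷ _) (inj₂ ey ∷ _) (x~y , _) =
      ⊥-elim (noClash (x , y , x∈ , y∈ , x~y , trans ex (sym ey)))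
    alternate-even x (y ∷ xs) ev ex (_ ∷ X∋) (inj₁ ey ∷ h) (_ , w) with alternate-odd y xs ev ey X∋ h w
    ... | (j , e) , q = (suc j , trans (cong suc e) (cong suc (sym (+-suc j j)))) , ey , q

  cycle-rotate : ∀ {X c z v xs} → v ∈ xs → TwoColouredCycle X c z xs → ∃ λ ys → TwoColouredCycle X c v ys
  cycle-rotate {X} {c} {z} {v} v∈ (u , X∋ , w , l , a , b , h) with ∈-∃++ v∈
  ... | as , bs , refl = bs ++ z ∷ as ,
    unique-resp-↭ rot u , All-resp-↭ rot X∋ , (let p , q = walk-split as w in walk-++ bs q p) ,
    ≤-trans l (≤-reflexive (suc-injective (↭-length rot))) , a , b , All-resp-↭ rot h
    where
    rot : z ∷ as ++ v ∷ bs ↭ v ∷ bs ++ z ∷ as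
    rot = ++-comm (z ∷ as) (v ∷ bs)

  cycle-reverse : ∀ {X c v xs} → TwoColouredCycle X c v xs → TwoColouredCycle X c v (reverse xs)
  cycle-reverse {xs = xs} (u , X∋ , w , l , a , b , h) =
    unique-resp-↭ rev u , All-resp-↭ rev X∋ , walk-reverse xs w ,
    ≤-trans l (≤-reflexive (sym (length-reverse xs))) , a , b , All-resp-↭ rev h
    where
    rev = prep _ (↭-sym (↭-reverse xs))

  cycle-alternates : ∀ {X c v xs} → ¬ Clash X c → TwoColouredCycle X c v xs →
                     ∃ λ a → ∃ λ b → lookup c v ≡ a × (∃ λ j → length xs ≡ suc (j + j)) × Alternating c b a xs
  cycle-alternates {xs = xs} nc (_ , X∋@(v∈ ∷ _) , w , _ , a , b , inj₁ e ∷ h) =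
    a , b , e , alternate-odd nc v∈ _ xs e e X∋ h w
  cycle-alternates {xs = xs} nc (_ , X∋@(v∈ ∷ _) , w , _ , a , b , inj₂ e ∷ h) =
    b , a , e , alternate-odd nc v∈ _ xs e e X∋ (All.map swap⊎ h) w

  ∈-∪⁅⁆ : ∀ {X : Subset n} {v x} → x ∈ₛ X ∪ ⁅ v ⁆ → v ≢ x → x ∈ₛ X
  ∈-∪⁅⁆ {X} {v} h v≢x with x∈p∪q⁻ X ⁅ v ⁆ h
  ... | inj₁ x∈ = x∈
  ... | inj₂ x∈ = contradiction (sym (x∈⁅y⁆⇒x≡y v x∈)) v≢x

  module _ (D : ℕ) where

    -- The vertex y at distance two along the cycle has the colour of v. If y is special, this
    -- coincidence alone is charged to y, whatever the cycle. Otherwise the cycle is among the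
    -- listed closed walks.
    cycle-event : ∀ {X c v xs} → ¬ Clash (X ∪ ⁅ v ⁆) c → TwoColouredCycle (X ∪ ⁅ v ⁆) c v xs →
                  ∀ j → length xs ≡ 3 + (j + j) →
                  (∃ λ w → w ∈ special D v × SameColour v w c) ⊎
                  (xs ∈ closedWalks D v (2 + (j + j)) × Periodic X v (1 + (j + j)) xs c)
    cycle-event {X} {c} {v} {x ∷ y ∷ xs} nc C@(u@((_ ∷ v≢y ∷ v∉) ∷ _) , (_ ∷ _ ∷ _ ∷ X∋) , w , _) j e
      with cycle-alternates {c = c} nc C | D <? codegree v y
    ... | a , b , ev , _ , ex , ey , q | yes sp =
      inj₁ (y , ∈-filter⁺ (λ w → D <? codegree v w) (∈-allFin y) sp , v≢y ∘ sym , trans ev (sym ey))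
    ... | a , b , ev , _ , refl , refl , q | no ¬sp = inj₂
      ( subst (λ m → x ∷ y ∷ xs ∈ closedWalks D v (suc m)) e′ (∈-closedWalks D {p = xs} w ¬sp)
      , (e′ , u , All.map (λ (h , k) → ∈-∪⁅⁆ h k) (All.zip (X∋ , v∉))) , ev , q)
      where
      e′ : length xs ≡ suc (j + j)
      e′ = suc-injective (suc-injective e)

    -- Since c is valid on X, a new defect involves v: either a neighbour of v shares its colour, or
    -- a two-coloured cycle passes through v. Such a cycle is rotated to start at v and read in both
    -- directions. If neither reading meets a special vertex in second place, it supplies two
    -- distinct closed walks.
    event : ∀ {X c v} → Valid X c → Bad (X ∪ ⁅ v ⁆) c →
            (∃ λ w → w ∈ neighbours v × SameColour v w c) ⊎
            (∃ λ w → w ∈ special D v × SameColour v w c) ⊎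
            (∃ λ j → j < n × ∃ λ xs → ∃ λ ys → xs ≢ ys ×
              (xs ∈ closedWalks D v (2 + (j + j)) × Periodic X v (1 + (j + j)) xs c) ×
              (ys ∈ closedWalks D v (2 + (j + j)) × Periodic X v (1 + (j + j)) ys c))
    event {X} {c} {v} valid bad with clash? (X ∪ ⁅ v ⁆) c
    ... | yes (u , w , u∈ , w∈ , u~w , e) with v Finₚ.≟ u | v Finₚ.≟ w
    ...   | yes refl | _        = inj₁ (w , ∈-neighbours u~w , (λ { refl → irreflexive refl u~w }) , e)
    ...   | no  _    | yes refl = inj₁ (u , ∈-neighbours (symmetric u~w) , (λ { refl → irreflexive refl u~w }) , sym e)
    ...   | no v≢u   | no v≢w   = contradiction (inj₁ (u , w , ∈-∪⁅⁆ u∈ v≢u , ∈-∪⁅⁆ w∈ v≢w , u~w , e)) valid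
    event {X} {c} {v} valid (inj₁ clash)         | no nc = contradiction clash nc
    event {X} {c} {v} valid (inj₂ (z , xs , C@(u , X∋ , w , l , h))) | no nc with Membership._∈?_ (Finₚ._≟_ {n}) v (z ∷ xs)
    ... | no v∉ = contradiction (inj₂ (z , xs , u ,
            All.tabulate (λ x∈ → ∈-∪⁅⁆ (All.lookup X∋ x∈) (λ { refl → v∉ x∈ })) , w , l , h)) valid
    ... | yes v∈ = at (start v∈)
      where
      start : v ∈ z ∷ xs → ∃ λ ys → TwoColouredCycle (X ∪ ⁅ v ⁆) c v ys
      start (here refl) = xs , C
      start (there i)   = cycle-rotate {c = c} i C
      at : (∃ λ ys → TwoColouredCycle (X ∪ ⁅ v ⁆) c v ys) → _
      at (ys , C@(u@(_ ∷ u′) , _ , _ , l , _)) with cycle-alternates {c = c} nc C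
      -- `zero` would mean a single interior vertex. The index is therefore lowered by one below,
      -- and `j` belongs to cycles of length 2j + 4.
      ... | _ , _ , _ , (zero , e) , _ = contradiction (≤-trans l (≤-reflexive e)) λ { (s≤s ()) }
      ... | _ , _ , _ , (suc j , e) , _
        with e′ ← trans e (cong (λ m → suc (suc m)) (+-suc j j))
        with cycle-event {c = c} nc C j e′ | cycle-event {c = c} nc (cycle-reverse {c = c} C) j (trans (length-reverse ys) e′)
      ...   | inj₁ s | _      = inj₂ (inj₁ s)
      ...   | inj₂ _ | inj₁ s = inj₂ (inj₁ s)
      ...   | inj₂ p | inj₂ q = inj₂ (inj₂ (j ,
        -- The cycle has 2j + 4 distinct vertices, whence j < n.
        ≤-trans (≤-trans (s≤s (m≤m+n j j)) (≤-trans (m≤n+m _ 2) (≤-reflexive (sym e′)))) (≤-trans (m≤n+m _ 1) (unique⇒length≤ u)) ,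
        ys , reverse ys , unique⇒≢reverse u′ l , p , q))

-- Geometric series over the naturals.

∑-downFrom-suc : ∀ J (f : ℕ → ℕ) → ∑ (downFrom (suc J)) f ≡ f 0 + ∑ (downFrom J) (f ∘ suc)
∑-downFrom-suc zero    f = refl
∑-downFrom-suc (suc J) f = trans (cong (f (suc J) +_) (∑-downFrom-suc J f)) (swap (f (suc J)) (f 0) _)
  where
  swap : ∀ a b c → a + (b + c) ≡ b + (a + c)
  swap = solve-∀

-- ∑ⱼ C (p/q)ʲ ≤ C / (1 − p/q) for q = p + w, with denominators cleared.
geometric : ∀ {p w C} .{{_ : NonZero (p + w)}} (f : ℕ → ℕ) → (∀ j → (p + w) ^ j * f j ≤ C * p ^ j) →
            ∀ J → w * ∑ (downFrom J) f ≤ C * (p + w)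
geometric {p} {w} {C} f h J = *-cancelˡ-≤ (q ^ J) {{m^n≢0 q J}}
  (≤-trans (m≤m+n _ _) (≤-trans (partial J) (≤-reflexive (*-comm (C * q) (q ^ J)))))
  where
  open ≤-Reasoning
  q = p + w
  -- Divided by q^J this reads w S + C q (p/q)^J ≤ C q, where S is the sum of the first J terms; the
  -- remainder term is kept so that the induction closes.
  partial : ∀ J → q ^ J * (w * ∑ (downFrom J) f) + C * q * p ^ J ≤ C * q * q ^ J
  partial zero    = ≤-reflexive (cong (_+ C * q * 1) (trans (*-identityˡ (w * 0)) (*-zeroʳ w)))
  partial (suc J) = begin
    q * q ^ J * (w * (f J + S)) + C * q * (p * p ^ J)
      ≡⟨ regroup p w C (q ^ J) (p ^ J) (f J) S ⟩
    q * (w * (q ^ J * f J) + (q ^ J * (w * S) + C * (p * p ^ J)))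
      ≤⟨ *-monoʳ-≤ q (+-monoˡ-≤ _ (*-monoʳ-≤ w (h J))) ⟩
    q * (w * (C * p ^ J) + (q ^ J * (w * S) + C * (p * p ^ J)))
      ≡⟨ regroup′ p w C (q ^ J * (w * S)) (p ^ J) ⟩
    q * (q ^ J * (w * S) + C * q * p ^ J)
      ≤⟨ *-monoʳ-≤ q (partial J) ⟩
    q * (C * q * q ^ J)
      ≡⟨ assoc q C (q ^ J) ⟩
    C * q * (q * q ^ J) ∎
    where
    S = ∑ (downFrom J) f
    regroup : ∀ p w C Q P F S → (p + w) * Q * (w * (F + S)) + C * (p + w) * (p * P) ≡
                                (p + w) * (w * (Q * F) + (Q * (w * S) + C * (p * P)))
    regroup = solve-∀
    regroup′ : ∀ p w C X P → (p + w) * (w * (C * P) + (X + C * (p * P))) ≡ (p + w) * (X + C * (p + w) * P)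
    regroup′ = solve-∀
    assoc : ∀ q C Q → q * (C * q * Q) ≡ C * q * (q * Q)
    assoc = solve-∀

^-double : ∀ x j → x ^ (j + j) ≡ (x * x) ^ j
^-double x zero    = refl
^-double x (suc j) = trans (cong (λ m → x * x ^ m) (+-suc j j))
  (trans (cong (λ m → x * (x * m)) (^-double x j)) (sym (*-assoc x x _)))

-- Union bound over the failures, summed over all colourings.

module Counting {n k : ℕ} (G : Graph n) where
  open Graph G
  open Walks G
  open Partial {n} {k} G
  open Events {n} {k} G

  private
    V = Fin n

  module _ (D : ℕ) (X : Subset n) (v : V) where

    #recurrent : ℕ → ℕ
    #recurrent j = ∑ (closedWalks D v (2 + (j + j))) (#periodic X v (1 + (j + j)))

    private
      same : V → Vec (Fin k) n → ℕ
      same w c = 𝟙 (valid? X c ×-dec sameColour? v w c)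
      periodic : ℕ → List V → Vec (Fin k) n → ℕ
      periodic j xs c = 𝟙 (valid? X c ×-dec periodic? X v (1 + (j + j)) xs c)
      sameAs : List V → Vec (Fin k) n → ℕ
      sameAs ws c = ∑[ w ∈ ws ] same w c
      recurrent : Vec (Fin k) n → ℕ
      recurrent c = ∑[ j ∈ downFrom n ] ∑[ xs ∈ closedWalks D v (2 + (j + j)) ] periodic j xs c

    -- A two-coloured cycle is met twice, once in each direction.
    valid-extend : ∀ c → 2 * 𝟙 (valid? X c) ≤
                   2 * 𝟙 (valid? (X ∪ ⁅ v ⁆) c) + (2 * sameAs (neighbours v) c + (2 * sameAs (special D v) c + recurrent c))
    valid-extend c = decide (valid? X c) (bad? (X ∪ ⁅ v ⁆) c)
      where
      N = 2 * sameAs (neighbours v) c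
      S = 2 * sameAs (special D v) c
      at-least : ∀ {P : Set} (P? : Dec P) → P → 1 ≤ 𝟙 P?
      at-least P? p = ≤-reflexive (sym (𝟙-yes P? p))
      decide : (d : Dec (Valid X c)) (e : Dec (Bad (X ∪ ⁅ v ⁆) c)) → 2 * 𝟙 d ≤
               2 * 𝟙 (¬? e) + (2 * sameAs (neighbours v) c + (2 * sameAs (special D v) c + recurrent c))
      decide (no  _) _       = z≤n
      decide (yes _) (no  _) = m≤m+n 2 _
      decide (yes h) (yes b) with event D h b
      ... | inj₁ (w , w∈ , s) = ≤-trans (*-monoʳ-≤ 2 (≤-trans (at-least (valid? X c ×-dec sameColour? v w c) (h , s))
              (∑-member (λ w → same w c) w∈))) (m≤m+n N _)
      ... | inj₂ (inj₁ (w , w∈ , s)) = ≤-trans (≤-trans (*-monoʳ-≤ 2 (≤-trans (at-least (valid? X c ×-dec sameColour? v w c) (h , s))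
              (∑-member (λ w → same w c) w∈))) (m≤m+n S _)) (m≤n+m _ N)
      ... | inj₂ (inj₂ (j , j<n , xs , ys , xs≢ys , (xs∈ , p) , (ys∈ , q))) = begin
        2 ≤⟨ +-mono-≤ (at-least (valid? X c ×-dec periodic? X v (1 + (j + j)) xs c) (h , p))
                      (at-least (valid? X c ×-dec periodic? X v (1 + (j + j)) ys c) (h , q)) ⟩
        periodic j xs c + periodic j ys c
          ≤⟨ ∑-members (λ xs → periodic j xs c) xs∈ ys∈ xs≢ys ⟩
        ∑[ xs ∈ closedWalks D v (2 + (j + j)) ] periodic j xs c
          ≤⟨ ∑-member (λ j → ∑[ xs ∈ closedWalks D v (2 + (j + j)) ] periodic j xs c) (∈-downFrom⁺ j<n) ⟩
        recurrent c ≤⟨ ≤-trans (m≤n+m _ S) (m≤n+m _ N) ⟩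
        2 * sameAs (neighbours v) c + (2 * sameAs (special D v) c + recurrent c) ∎
        where open ≤-Reasoning

    count-extend : 2 * #valid X ≤ 2 * #valid (X ∪ ⁅ v ⁆) +
                   (2 * ∑ (neighbours v) (#same X v) + (2 * ∑ (special D v) (#same X v) + ∑ (downFrom n) #recurrent))
    count-extend = begin
      2 * #valid X ≡⟨ ∑-* C 2 _ ⟨
      ∑[ c ∈ C ] (2 * 𝟙 (valid? X c)) ≤⟨ ∑-mono C (λ {c} _ → valid-extend c) ⟩
      ∑[ c ∈ C ] (2 * 𝟙 (valid? (X ∪ ⁅ v ⁆) c) + (2 * sameAs (neighbours v) c + (2 * sameAs (special D v) c + recurrent c)))
        ≡⟨ trans (∑-+ C _ _) (cong₂ _+_ (∑-* C 2 _) (trans (∑-+ C _ _) (cong₂ _+_ (collect (neighbours v))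
             (trans (∑-+ C _ _) (cong₂ _+_ (collect (special D v)) collect′))))) ⟩
      2 * #valid (X ∪ ⁅ v ⁆) +
        (2 * ∑ (neighbours v) (#same X v) + (2 * ∑ (special D v) (#same X v) + ∑ (downFrom n) #recurrent)) ∎
      where
      open ≤-Reasoning
      C = colourings n
      collect : ∀ ws → ∑[ c ∈ C ] (2 * sameAs ws c) ≡ 2 * ∑ ws (#same X v)
      collect ws = trans (∑-* C 2 _) (cong (2 *_) (∑-swap C ws (λ c w → same w c)))
      collect′ : ∑ C recurrent ≡ ∑ (downFrom n) #recurrent
      collect′ = trans (∑-swap C (downFrom n) _) (∑-cong (downFrom n) λ j →
        ∑-swap C (closedWalks D v (2 + (j + j))) (λ c xs → periodic j xs c))

    module _ (v∉X : v ∉ₛ X) where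

      count-same-bound : ∀ ws → k * ∑ ws (#same X v) ≤ length ws * #valid X
      count-same-bound ws = ≤-trans (≤-reflexive (sym (∑-* ws k _))) (∑-bound ws λ {w} _ → count-same v∉X w)

      count-recurrent-bound : ∀ {β} .{{_ : NonZero k}} → (∀ Y → ∣ Y ∣ < ∣ X ∣ → Extensible β Y) → ∀ j →
        β ^ (1 + (j + j)) * (k * #recurrent j) ≤ length (ordinaryWalks D v (2 + (j + j))) * D * #valid X
      count-recurrent-bound {β} ext j = begin
        b * (k * #recurrent j)       ≡⟨ *-assoc b k _ ⟨
        b * k * #recurrent j         ≡⟨ ∑-* Z (b * k) _ ⟨
        ∑[ xs ∈ Z ] (b * k * #p xs)  ≤⟨ ∑-bound Z (λ {xs} _ → ≤-trans (≤-reflexive (*-assoc b k (#p xs)))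
                                          (count-periodic {β} v∉X ext (1 + (j + j)) xs)) ⟩
        length Z * #valid X          ≤⟨ *-monoˡ-≤ (#valid X) (length-closedWalks D v (2 + (j + j))) ⟩
        length (ordinaryWalks D v (2 + (j + j))) * D * #valid X ∎
        where
        open ≤-Reasoning
        b = β ^ (1 + (j + j))
        Z = closedWalks D v (2 + (j + j))
        #p = #periodic X v (1 + (j + j))

-- The induction, with the parameters left abstract.

-- M colours pay for the vertices of large codegree and the 4-cycles, and R
-- colours for the longer cycles.
module Colouring {n Δ D β M R w : ℕ} (G : Graph n) (deg≤Δ : ∀ v → degree G v ≤ Δ)
  .{{_ : NonZero β}} .{{_ : NonZero w}}
  (2β≡D² : 2 * β ≡ D * suc D) (special-room : D * (Δ * Δ) ≤ 2 * β * M)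
  (β²≡Δ²+w : β * β ≡ Δ * Δ + w) (long-room : D * (Δ * Δ * (Δ * Δ)) ≤ 2 * R * (β * w)) where

  colours : ℕ
  colours = Δ + M + R + β

  private
    k = colours
    instance
      k≢0 : NonZero k
      k≢0 = >-nonZero (≤-trans (>-nonZero⁻¹ β) (m≤n+m β _))

  open Graph G
  open Walks G
  open Partial {n} {k} G
  open Events {n} {k} G
  open Counting {n} {k} G

  module _ (X : Subset n) (ext : ∀ Y → ∣ Y ∣ < ∣ X ∣ → Extensible β Y) (v : Fin n) (v∉X : v ∉ₛ X) where

    private
      open ≤-Reasoning
      a = #valid X
      a′ = #valid (X ∪ ⁅ v ⁆)
      s = length (special D v)
      t = length (ordinaryWalks D v 2)
      p = Δ * Δ
      q = p + w
      instance
        q≢0 : NonZero q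
        q≢0 = >-nonZero (≤-trans (>-nonZero⁻¹ w) (m≤n+m w p))
        βw≢0 : NonZero (β * w)
        βw≢0 = m*n≢0 β w

      N : ℕ → ℕ
      N j = k * #recurrent D X v j

      long : ℕ
      long = ∑ (downFrom n) (N ∘ suc)

    -- The index 0 stands for the 4-cycles. After multiplication by β, an ordinary walk of length
    -- two costs D, and a special vertex costs 2β = D(D + 1), which is D for each of D + 1 walks
    -- ending in it. This balance is the reason for the value of β: by `length-special` the total is
    -- at most D Δ².
    four-cycles : 2 * (s * a) + N 0 ≤ 2 * (M * a)
    four-cycles = *-cancelˡ-≤ β (begin
      β * (2 * (s * a) + N 0)          ≡⟨ regroup β s a (N 0) ⟩
      2 * β * (s * a) + β * 1 * N 0    ≤⟨ +-monoʳ-≤ _ (count-recurrent-bound D X v v∉X {β} ext 0) ⟩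
      2 * β * (s * a) + t * D * a      ≡⟨ cong (λ z → z * (s * a) + t * D * a) 2β≡D² ⟩
      D * suc D * (s * a) + t * D * a  ≡⟨ regroup′ D s t a ⟩
      D * (s * suc D + t) * a          ≤⟨ *-monoˡ-≤ a (*-monoʳ-≤ D (≤-trans (length-special D v) (length-walksTo deg≤Δ v 2))) ⟩
      D * (Δ ^ 2) * a                  ≡⟨ cong (λ z → D * (Δ * z) * a) (*-identityʳ Δ) ⟩
      D * p * a                        ≤⟨ *-monoˡ-≤ a special-room ⟩
      2 * β * M * a                    ≡⟨ regroup″ β M a ⟩
      β * (2 * (M * a))                ∎)
      where
      regroup : ∀ β s a N → β * (2 * (s * a) + N) ≡ 2 * β * (s * a) + β * 1 * N
      regroup = solve-∀
      regroup′ : ∀ D s t a → D * suc D * (s * a) + t * D * a ≡ D * (s * suc D + t) * a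
      regroup′ = solve-∀
      regroup″ : ∀ β M a → 2 * β * M * a ≡ β * (2 * (M * a))
      regroup″ = solve-∀

    -- Lengthening the cycle by two multiplies the bound by Δ²/β² = p/q, which is below 1 by the
    -- choice of w. The geometric series sums to D Δ⁴ a / (β w), and `long-room` bounds this by 2 R
    -- a.
    long-cycles : long ≤ 2 * (R * a)
    long-cycles = *-cancelˡ-≤ (β * w) (*-cancelˡ-≤ q (begin
      q * (β * w * long)                              ≡⟨ regroup q β w long ⟩
      w * (β * q * long)                              ≡⟨ cong (w *_) (∑-* (downFrom n) (β * q) _) ⟨
      w * ∑[ j ∈ downFrom n ] (β * q * N (suc j))     ≤⟨ geometric {p} {w} {D * (p * p) * a} (λ j → β * q * N (suc j)) bound n ⟩
      D * (p * p) * a * q                             ≤⟨ *-monoˡ-≤ q (*-monoˡ-≤ a long-room) ⟩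
      2 * R * (β * w) * a * q                         ≡⟨ regroup′ R (β * w) a q ⟩
      q * (β * w * (2 * (R * a)))                     ∎))
      where
      regroup : ∀ q β w L → q * (β * w * L) ≡ w * (β * q * L)
      regroup = solve-∀
      regroup′ : ∀ R b a q → 2 * R * b * a * q ≡ q * (b * (2 * (R * a)))
      regroup′ = solve-∀
      regroup₁ : ∀ β q Q N → Q * (β * q * N) ≡ β * (q * Q) * N
      regroup₁ = solve-∀
      regroup₂ : ∀ Δ D P a → Δ * (Δ * (Δ * Δ * P)) * D * a ≡ D * (Δ * Δ * (Δ * Δ)) * a * P
      regroup₂ = solve-∀
      bound : ∀ j → q ^ j * (β * q * N (suc j)) ≤ D * (p * p) * a * p ^ j
      bound j = begin
        q ^ j * (β * q * N (suc j))
          ≡⟨ regroup₁ β q (q ^ j) (N (suc j)) ⟩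
        β * q ^ suc j * N (suc j)
          ≡⟨ cong (λ z → β * z * N (suc j)) (trans (^-double β (suc j)) (cong (_^ suc j) β²≡Δ²+w)) ⟨
        β ^ (1 + (suc j + suc j)) * N (suc j)
          ≤⟨ count-recurrent-bound D X v v∉X {β} ext (suc j) ⟩
        length (ordinaryWalks D v (2 + (suc j + suc j))) * D * a
          ≤⟨ *-monoˡ-≤ a (*-monoˡ-≤ D (≤-trans (length-filter _ (walksTo v (2 + (suc j + suc j))))
               (length-walksTo deg≤Δ v (2 + (suc j + suc j))))) ⟩
        Δ ^ (2 + (suc j + suc j)) * D * a
          ≡⟨ cong (λ z → Δ * (Δ * z) * D * a) (^-double Δ (suc j)) ⟩
        Δ * (Δ * (p * p ^ j)) * D * a
          ≡⟨ regroup₂ Δ D (p ^ j) a ⟩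
        D * (p * p) * a * p ^ j ∎

    extend-step : β * a ≤ k * a′
    -- Adding the losses Δ, M and R to both sides turns β into k on the left, so that `count-extend`
    -- applies without subtraction.
    extend-step = *-cancelˡ-≤ 2 (+-cancelʳ-≤ (2 * (Δ * a) + (2 * (M * a) + 2 * (R * a))) _ _ (begin
      2 * (β * a) + (2 * (Δ * a) + (2 * (M * a) + 2 * (R * a)))
        ≡⟨ regroup Δ M R β a ⟩
      k * (2 * a)
        ≤⟨ *-monoʳ-≤ k (count-extend D X v) ⟩
      k * (2 * a′ + (2 * nb + (2 * sp + rec)))
        ≡⟨ regroup′ k a′ nb sp rec ⟩
      2 * (k * a′) + (2 * (k * nb) + (2 * (k * sp) + k * rec))
        ≤⟨ +-monoʳ-≤ (2 * (k * a′)) (+-mono-≤ (*-monoʳ-≤ 2 neighbours-bound)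
             (≤-trans (+-mono-≤ (*-monoʳ-≤ 2 (count-same-bound D X v v∉X (special D v))) recurrent-bound)
             (≤-trans (≤-reflexive (sym (+-assoc (2 * (s * a)) (N 0) long))) (+-mono-≤ four-cycles long-cycles)))) ⟩
      2 * (k * a′) + (2 * (Δ * a) + (2 * (M * a) + 2 * (R * a))) ∎))
      where
      nb  = ∑ (neighbours v) (#same X v)
      sp  = ∑ (special D v) (#same X v)
      rec = ∑ (downFrom n) (#recurrent D X v)
      neighbours-bound : k * nb ≤ Δ * a
      neighbours-bound = ≤-trans (count-same-bound D X v v∉X (neighbours v)) (*-monoˡ-≤ a (deg≤Δ v))
      recurrent-bound : k * rec ≤ N 0 + long
      recurrent-bound = begin
        k * rec               ≡⟨ ∑-* (downFrom n) k _ ⟨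
        -- One more term is allowed in, so that after splitting off index 0 the shifted sum has
        -- exactly n terms.
        ∑ (downFrom n) N      ≤⟨ m≤n+m _ (N n) ⟩
        ∑ (downFrom (suc n)) N ≡⟨ ∑-downFrom-suc n N ⟩
        N 0 + long            ∎
      regroup : ∀ Δ M R β a → 2 * (β * a) + (2 * (Δ * a) + (2 * (M * a) + 2 * (R * a))) ≡ (Δ + M + R + β) * (2 * a)
      regroup = solve-∀
      regroup′ : ∀ k a nb sp rec → k * (2 * a + (2 * nb + (2 * sp + rec))) ≡ 2 * (k * a) + (2 * (k * nb) + (2 * (k * sp) + k * rec))
      regroup′ = solve-∀

  extensible : ∀ X → Extensible β X
  extensible X = go (suc ∣ X ∣) X ≤-refl
    where
    go : ∀ m Y → ∣ Y ∣ < m → Extensible β Y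
    go (suc m) Y h = extend-step Y λ Z Z<Y → go m Z (≤-trans Z<Y (s≤s⁻¹ h))

  #valid-positive : ∀ X → 0 < #valid X
  #valid-positive X = go (suc ∣ X ∣) X ≤-refl
    where
    go : ∀ m Y → ∣ Y ∣ < m → 0 < #valid Y
    go (suc m) Y h with nonempty? Y
    -- Nothing in the empty set can be in conflict, so all k ^ n colourings are valid.
    ... | no empty = ≤-trans (≤-trans (m^n>0 k n) (≤-reflexive (sym (length-colourings n))))
      (≤-trans (≤-reflexive (sym (trans (∑-const (colourings n) 1) (*-identityʳ _)))) (∑-mono (colourings n) λ {c} _ →
        ≤-reflexive (sym (𝟙-yes (valid? Y c) λ
          { (inj₁ (u , _ , u∈ , _)) → empty (u , u∈)
          ; (inj₂ (u , _ , _ , u∈ ∷ _ , _)) → empty (u , u∈) }))))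
    ... | yes (x , x∈) = ≤-trans (*-cancelˡ-< k 0 _ (begin-strict
        k * 0                           ≡⟨ *-zeroʳ k ⟩
        0                               <⟨ *-mono-< (>-nonZero⁻¹ β) (go m (Y - x) (≤-trans (x∈p⇒∣p-x∣<∣p∣ x∈) (s≤s⁻¹ h))) ⟩
        β * #valid (Y - x)              ≤⟨ extensible (Y - x) x (x∉p-x Y x) ⟩
        k * #valid ((Y - x) ∪ ⁅ x ⁆)    ∎)) (#valid-antitone (restore x))
      where open ≤-Reasoning

  acyclicallyColourable : AcyclicallyColourable G colours
  acyclicallyColourable with count-some (valid? ⊤) (colourings n) (#valid-positive ⊤)
  ... | c , h = lookup c , valid⇒acyclic {c} h

-- Choice of the parameters and the integer inequalities.

triangular : ∀ m → ∃ λ t → 2 * t ≡ m * suc m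
triangular zero    = 0 , refl
triangular (suc m) = let t , e = triangular m in
  t + suc m , trans (*-distribˡ-+ 2 t (suc m)) (trans (cong (_+ 2 * suc m) e) (regroup m))
  where
  regroup : ∀ m → m * suc m + 2 * suc m ≡ suc m * suc (suc m)
  regroup = solve-∀

-- Taking the root of Δ² - 1 keeps b strictly below Δ^(2/3) even when Δ² is a cube. Since 24² = 576
-- exceeds 8³ = 512, b is at least 8.
cube-below-square : ∀ {Δ} → 24 ≤ Δ → ∃ λ b → 8 ≤ b × cube b < Δ * Δ × Δ * Δ ≤ cube (suc b)
cube-below-square {Δ} 24≤Δ with Δ * Δ | *-mono-≤ 24≤Δ 24≤Δ
... | suc m | 576≤ with icbrt-spec m
...   | lo , hi = icbrt m , ≮⇒≥ small , s≤s lo , hi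
  where
  small : icbrt m ≮ 8
  small h = <⇒≱ {512} {576} (m≤m+n 513 63) (≤-trans 576≤ (≤-trans hi (cube-mono h)))

square-cancel-< : ∀ {m n} → m * m < n * n → m < n
square-cancel-< {m} {n} h with n ≤? m
... | yes n≤m = contradiction (*-mono-≤ n≤m n≤m) (<⇒≱ h)
... | no  n≰m = ≰⇒> n≰m

-- In squares: 25b² ≤ 32b² ≤ 4b³ < 4Δ². This converts terms linear in b into multiples of Δ.
5b≤2Δ : ∀ {b Δ} → 8 ≤ b → cube b < Δ * Δ → 5 * b ≤ 2 * Δ
5b≤2Δ {b} {Δ} 8≤b h = <⇒≤ (square-cancel-< (begin-strict
  5 * b * (5 * b)   ≡⟨ regroup b ⟩
  25 * (b * b)      ≤⟨ *-monoˡ-≤ (b * b) (≤-trans (m≤m+n 25 7) (*-monoʳ-≤ 4 8≤b)) ⟩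
  4 * b * (b * b)   ≡⟨ regroup′ b ⟩
  4 * cube b        <⟨ *-monoʳ-< 4 h ⟩
  4 * (Δ * Δ)       ≡⟨ regroup″ Δ ⟩
  2 * Δ * (2 * Δ)   ∎))
  where
  open ≤-Reasoning
  regroup : ∀ b → 5 * b * (5 * b) ≡ 25 * (b * b)
  regroup = solve-∀
  regroup′ : ∀ b → 4 * b * (b * b) ≡ 4 * (b * b * b)
  regroup′ = solve-∀
  regroup″ : ∀ Δ → 4 * (Δ * Δ) ≡ 2 * Δ * (2 * Δ)
  regroup″ = solve-∀

-- With D = b + 1 one has Δ² ≤ D³, and each requirement of `Colouring` reduces to a polynomial
-- inequality in b. The leading term of k is b² from M plus b²/2 from β.
few-colours : ∀ {n b Δ} (G : Graph n) → (∀ v → degree G v ≤ Δ) → 8 ≤ b → Δ * Δ ≤ cube (suc b) →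
              ∃ λ k → AcyclicallyColourable G k × 2 * k ≡ 2 * Δ + (3 * (b * b) + 13 * b + 24)
few-colours {n} {b} {Δ} G deg≤Δ 8≤b Δ²≤ =
  Col.colours , Col.acyclicallyColourable , trans (expand Δ M R β) (trans (cong (2 * Δ + 2 * M + 2 * R +_) 2β≡) (collect Δ b))
  where
  open ≤-Reasoning
  D = suc b
  p = Δ * Δ
  -- Because D³ + 1 = (D + 1)(D² - D + 1), and the last factor is b² + b + 1, this M satisfies D³ ≤
  -- (D + 1) M with a loss of only 1.
  M = b * b + b + 1
  -- `quartic` asks for R ≥ 4(b + 1)⁴ / (b²(b + 2)), whose polynomial part is 4b + 8. At b = 8 the
  -- value 4b + 9 just falls short.
  R = 4 * b + 10
  β = proj₁ (triangular D)
  2β≡ : 2 * β ≡ D * suc D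
  2β≡ = proj₂ (triangular D)
  w = β * β ∸ p
  -- The identity behind this is (D(D + 1))² - 4D³ = (D(D - 1))² with D - 1 = b.
  four-w : 4 * p + D * D * (b * b) ≤ 4 * (β * β)
  four-w = begin
    4 * p + D * D * (b * b)       ≤⟨ +-monoˡ-≤ _ (*-monoʳ-≤ 4 Δ²≤) ⟩
    4 * cube D + D * D * (b * b)  ≡⟨ square b ⟩
    D * suc D * (D * suc D)       ≡⟨ cong₂ _*_ 2β≡ 2β≡ ⟨
    2 * β * (2 * β)               ≡⟨ regroup β ⟩
    4 * (β * β)                   ∎
    where
    square : ∀ b → 4 * (suc b * suc b * suc b) + suc b * suc b * (b * b) ≡ suc b * suc (suc b) * (suc b * suc (suc b))
    square = solve-∀
    regroup : ∀ β → 2 * β * (2 * β) ≡ 4 * (β * β)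
    regroup = solve-∀
  p≤β² : p ≤ β * β
  p≤β² = *-cancelˡ-≤ 4 (≤-trans (m≤m+n _ _) four-w)
  β²≡ : β * β ≡ p + w
  β²≡ = sym (m+[n∸m]≡n p≤β²)
  4w≥ : D * D * (b * b) ≤ 4 * w
  4w≥ = +-cancelˡ-≤ (4 * p) _ _ (≤-trans four-w (≤-reflexive (trans (cong (4 *_) β²≡) (*-distribˡ-+ 4 p w))))
  0<b : 0 < b
  0<b = ≤-trans (s≤s z≤n) 8≤b
  instance
    β≢0 : NonZero β
    β≢0 = >-nonZero (*-cancelˡ-< 2 0 β (≤-trans (s≤s z≤n) (≤-reflexive (sym 2β≡))))
    w≢0 : NonZero w
    w≢0 = >-nonZero (*-cancelˡ-< 4 0 w (<-≤-trans (*-mono-< {0} {D * D} (s≤s z≤n) (*-mono-< {0} {b} 0<b 0<b)) 4w≥))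
  special-room : D * p ≤ 2 * β * M
  special-room = begin
    D * p             ≤⟨ *-monoʳ-≤ D (≤-trans Δ²≤ (≤-trans (n≤1+n _) (≤-reflexive (cubes b)))) ⟩
    D * (suc D * M)   ≡⟨ *-assoc D (suc D) M ⟨
    D * suc D * M     ≡⟨ cong (_* M) 2β≡ ⟨
    2 * β * M         ∎
    where
    cubes : ∀ b → suc (suc b * suc b * suc b) ≡ suc (suc b) * (b * b + b + 1)
    cubes = solve-∀
  quartic : 4 * (D * D * (D * D)) ≤ R * suc D * (b * b)
  -- With b = 8 + e the difference of the two sides has positive coefficients.
  quartic = subst (λ b → 4 * (suc b * suc b * (suc b * suc b)) ≤ (4 * b + 10) * suc (suc b) * (b * b))
    (m+[n∸m]≡n 8≤b) (≤-trans (m≤m+n _ _) (≤-reflexive (slack (b ∸ 8))))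
    where
    slack : ∀ e → 4 * ((9 + e) * (9 + e) * ((9 + e) * (9 + e))) + (2 * (e * e * e) + 44 * (e * e) + 304 * e + 636) ≡
                  (4 * (8 + e) + 10) * (10 + e) * ((8 + e) * (8 + e))
    slack = solve-∀
  -- This is `quartic` times D³, by Δ⁴ ≤ D⁶, 2β = D(D + 1) and 4w ≥ D²b².
  long-room : D * (p * p) ≤ 2 * R * (β * w)
  long-room = *-cancelˡ-≤ 4 (begin
    4 * (D * (p * p))                          ≤⟨ *-monoʳ-≤ 4 (*-monoʳ-≤ D (*-mono-≤ Δ²≤ Δ²≤)) ⟩
    4 * (D * (cube D * cube D))                ≡⟨ regroup D ⟩
    cube D * (4 * (D * D * (D * D)))           ≤⟨ *-monoʳ-≤ (cube D) quartic ⟩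
    cube D * (R * suc D * (b * b))             ≡⟨ regroup′ D R (suc D) b ⟩
    R * (D * suc D) * (D * D * (b * b))        ≤⟨ *-monoʳ-≤ (R * (D * suc D)) 4w≥ ⟩
    R * (D * suc D) * (4 * w)                  ≡⟨ cong (λ z → R * z * (4 * w)) 2β≡ ⟨
    R * (2 * β) * (4 * w)                      ≡⟨ regroup″ R β w ⟩
    4 * (2 * R * (β * w))                      ∎)
    where
    regroup : ∀ D → 4 * (D * (D * D * D * (D * D * D))) ≡ D * D * D * (4 * (D * D * (D * D)))
    regroup = solve-∀
    regroup′ : ∀ D R E b → D * D * D * (R * E * (b * b)) ≡ R * (D * E) * (D * D * (b * b))
    regroup′ = solve-∀
    regroup″ : ∀ R β w → R * (2 * β) * (4 * w) ≡ 4 * (2 * R * (β * w))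
    regroup″ = solve-∀
  module Col = Colouring {n} {Δ} {D} {β} {M} {R} {w} G deg≤Δ 2β≡ special-room β²≡ long-room
  expand : ∀ Δ M R β → 2 * (Δ + M + R + β) ≡ 2 * Δ + 2 * M + 2 * R + 2 * β
  expand = solve-∀
  collect : ∀ Δ b → 2 * Δ + 2 * (b * b + b + 1) + 2 * (4 * b + 10) + suc b * suc (suc b) ≡
                    2 * Δ + (3 * (b * b) + 13 * b + 24)
  collect = solve-∀

-- As b ≥ 8, the surplus 13b + 54 is at most 20b = 4 · 5b, and `5b≤2Δ` turns this into 8Δ.
first-bound : ∀ {b Δ k} → 8 ≤ b → cube b < Δ * Δ → 2 * k ≡ 2 * Δ + (3 * (b * b) + 13 * b + 24) →
              2 * k + 30 ≤ 3 * (b * b) + 10 * Δ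
first-bound {b} {Δ} {k} 8≤b h e = begin
  2 * k + 30                                         ≡⟨ cong (_+ 30) e ⟩
  2 * Δ + (3 * (b * b) + 13 * b + 24) + 30           ≡⟨ regroup Δ b ⟩
  3 * (b * b) + 2 * Δ + (13 * b + 54)                ≤⟨ +-monoʳ-≤ (3 * (b * b) + 2 * Δ) (+-monoʳ-≤ (13 * b) (≤-trans (m≤m+n 54 2) (*-monoʳ-≤ 7 8≤b))) ⟩
  3 * (b * b) + 2 * Δ + (13 * b + 7 * b)             ≡⟨ regroup′ Δ b ⟩
  3 * (b * b) + 2 * Δ + 4 * (5 * b)                  ≤⟨ +-monoʳ-≤ (3 * (b * b) + 2 * Δ) (*-monoʳ-≤ 4 (5b≤2Δ {b} {Δ} 8≤b h)) ⟩
  3 * (b * b) + 2 * Δ + 4 * (2 * Δ)                  ≡⟨ regroup″ Δ b ⟩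
  3 * (b * b) + 10 * Δ                               ∎
  where
  open ≤-Reasoning
  regroup : ∀ Δ b → 2 * Δ + (3 * (b * b) + 13 * b + 24) + 30 ≡ 3 * (b * b) + 2 * Δ + (13 * b + 54)
  regroup = solve-∀
  regroup′ : ∀ Δ b → 3 * (b * b) + 2 * Δ + (13 * b + 7 * b) ≡ 3 * (b * b) + 2 * Δ + 4 * (5 * b)
  regroup′ = solve-∀
  regroup″ : ∀ Δ b → 3 * (b * b) + 2 * Δ + 4 * (2 * Δ) ≡ 3 * (b * b) + 10 * Δ
  regroup″ = solve-∀

-- As b ≥ 8, 13b + 24 is at most 16b, twice the 8b that `quotient-lower` provides.
second-bound : ∀ {b Δ k} → 8 ≤ b → 2 * k ≡ 2 * Δ + (3 * (b * b) + 13 * b + 24) →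
               2 * k ≤ 3 * (b * b) + 2 * Δ + 16 * b
second-bound {b} {Δ} {k} 8≤b e = begin
  2 * k                                    ≡⟨ e ⟩
  2 * Δ + (3 * (b * b) + 13 * b + 24)      ≡⟨ regroup Δ b ⟩
  3 * (b * b) + 2 * Δ + 13 * b + 3 * 8     ≤⟨ +-monoʳ-≤ _ (*-monoʳ-≤ 3 8≤b) ⟩
  3 * (b * b) + 2 * Δ + 13 * b + 3 * b     ≡⟨ regroup′ Δ b ⟩
  3 * (b * b) + 2 * Δ + 16 * b             ∎
  where
  open ≤-Reasoning
  regroup : ∀ Δ b → 2 * Δ + (3 * (b * b) + 13 * b + 24) ≡ 3 * (b * b) + 2 * Δ + 13 * b + 24
  regroup = solve-∀
  regroup′ : ∀ Δ b → 3 * (b * b) + 2 * Δ + 13 * b + 3 * b ≡ 3 * (b * b) + 2 * Δ + 16 * b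
  regroup′ = solve-∀

-- Passage to the real inequality.

open import Data.Integer.Base using (+_)
open import Data.Rational.Base using (_/_)

theorem1 : ∀ {n} (G : Graph n) (Δ : ℕ) → maxDegree G ≡ Δ → (24≤Δ : 24 ≤ Δ) →
    fromℕℝ (χₐ G) <ℝ
    (fromℚ (+ 3 / 2) *ℝ Δ ^[ 4 /3] +ℝ fromℕℝ 5 *ℝ fromℕℝ Δ -ℝ fromℕℝ 14)
    ⊓ℝ
    (fromℚ (+ 3 / 2) *ℝ Δ ^[ 4 /3] +ℝ fromℕℝ Δ
    +ℝ (fromℕℝ 8 *ℝ Δ ^[ 4 /3]) /ℝ (Δ ^[ 2 /3] -ℝ fromℕℝ 4) [ Δ^⅔-4#0 24≤Δ ]
    +ℝ fromℕℝ 1)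
theorem1 G Δ refl 24≤Δ =
  let b , 8≤b , b³<Δ² , Δ²≤ = cube-below-square {Δ} 24≤Δ
      k , colourable , 2k≡ = few-colours {b = b} G (degree≤maxDegree G) 8≤b Δ²≤
      N , lower = cbrtSeq²-lower {b} {Δ} b³<Δ²
  -- The gap is 1: from index N on, both entries of the minimum are at least k + 1.
  in ℚ.1ℚ , 0<ι 0 , N , λ m N≤m →
    let q = cbrtSeq Δ m
        h = lower m N≤m
    in ℚₚ.≤-trans (ℚₚ.+-monoˡ-≤ ℚ.1ℚ (ι-mono-≤ (χₐ-minimal G k colourable)))
      (ℚₚ.⊓-glb (first-≤ q {b} {Δ} {k} h (first-bound {b} {Δ} {k} 8≤b b³<Δ² 2k≡))
                (second-≤ q {b} {Δ} {k} h 8≤b (second-bound {b} {Δ} {k} 8≤b 2k≡)))
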